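{- Let $k\geq 4$ be an integer and let $M$ be a simple minimally $k$-degenerate matroid. Then $|E(M)|\leq (k-1)(r(M)-1)+2$. Moreover, equality is attained if and only if $M\cong U_{2,k+1}$ or $M\cong U_{2,k+1}\oplus_2 U_{2,k+1}$.
   Context: All matroids are finite, loopless, with non-empty ground set; all restrictions considered are non-empty. The cogirth $g^*(M)$ is the size of a smallest cocircuit of $M$. For an integer $k\geq 2$, a loopless matroid $M$ is minimally $k$-degenerate if $g^*(M)=k$ and every proper (non-empty) restriction of $M$ has cogirth at most $k-1$. $U_{r,n}$ denotes the uniform matroid of rank $r$ on $n$ elements. If $E(M_1)\cap E(M_2)=\{p\}$, $|E(M_1)|,|E(M_2)|\ge 3$, and $p$ is neither a loop nor a coloop of $M_1$ or $M_2$, the $2$-sum $M_1\oplus_2 M_2$ at basepoint $p$ is the matroid on $(E(M_1)\cup E(M_2))-\{p\}$ whose circuits are the circuits of $M_1$ avoiding $p$, the circuits of $M_2$ avoiding $p$, and the sets $(C_1\cup C_2)-\{p\}$ where $C_i$ is a circuit of $M_i$ containing $p$ for $i=1,2$. Up to isomorphism, $U_{2,k+1}\oplus_2 U_{2,k+1}$ (for two copies sharing exactly one element) does not depend on the choice of basepoint. -}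

module Defs where

open import Level using (0ℓ)
open import Data.Bool using (true; false)
open import Data.Nat using (ℕ; zero; suc; _+_; _∸_; _≤_; _<_; z≤n; s≤s; _≟_; _≤?_)
open import Data.Nat.Properties
open import Data.Fin using (Fin)
open import Data.Fin.Properties using (any?)
open import Data.Fin.Subset
open import Data.Fin.Subset.Properties
open import Data.Vec using ([]; _∷_)
open import Data.Product using (∃; ∃-syntax; _×_; _,_; proj₁; proj₂)
open import Data.Sum using (_⊎_; inj₁; inj₂; [_,_]′)
open import Function using (_∘_; _↔_; _⇔_; Inverse)
open import Relation.Nullary using (¬_; Dec; yes; no; contradiction)
open import Relation.Nullary.Decidable using (_×-dec_; ¬?; map′; decidable-stable)
open import Relation.Unary using (Pred; Decidable)
open import Relation.Binary.PropositionalEquality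

private
  variable
    m n : ℕ
    p q r : Subset n

∣p∣≡∣p∩q∣+∣p─q∣ : ∀ (p q : Subset n) → ∣ p ∣ ≡ ∣ p ∩ q ∣ + ∣ p ─ q ∣
∣p∣≡∣p∩q∣+∣p─q∣ []          []          = refl
∣p∣≡∣p∩q∣+∣p─q∣ (true  ∷ p) (true  ∷ q) = cong suc (∣p∣≡∣p∩q∣+∣p─q∣ p q)
∣p∣≡∣p∩q∣+∣p─q∣ (true  ∷ p) (false ∷ q) =
  trans (cong suc (∣p∣≡∣p∩q∣+∣p─q∣ p q)) (sym (+-suc ∣ p ∩ q ∣ ∣ p ─ q ∣))
∣p∣≡∣p∩q∣+∣p─q∣ (false ∷ p) (true  ∷ q) = ∣p∣≡∣p∩q∣+∣p─q∣ p q
∣p∣≡∣p∩q∣+∣p─q∣ (false ∷ p) (false ∷ q) = ∣p∣≡∣p∩q∣+∣p─q∣ p q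

∣p∪q∣≤∣p∣+∣q∣ : ∀ (p q : Subset n) → ∣ p ∪ q ∣ ≤ ∣ p ∣ + ∣ q ∣
∣p∪q∣≤∣p∣+∣q∣ []          []          = z≤n
∣p∪q∣≤∣p∣+∣q∣ (true  ∷ p) (true  ∷ q) =
  s≤s (≤-trans (∣p∪q∣≤∣p∣+∣q∣ p q) (+-monoʳ-≤ ∣ p ∣ (n≤1+n ∣ q ∣)))
∣p∪q∣≤∣p∣+∣q∣ (true  ∷ p) (false ∷ q) = s≤s (∣p∪q∣≤∣p∣+∣q∣ p q)
∣p∪q∣≤∣p∣+∣q∣ (false ∷ p) (true  ∷ q) =
  ≤-trans (s≤s (∣p∪q∣≤∣p∣+∣q∣ p q)) (≤-reflexive (sym (+-suc ∣ p ∣ ∣ q ∣)))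
∣p∪q∣≤∣p∣+∣q∣ (false ∷ p) (false ∷ q) = ∣p∪q∣≤∣p∣+∣q∣ p q

x∈p─q⇒x∉q : ∀ (p q : Subset n) {x} → x ∈ p ─ q → x ∉ q
x∈p─q⇒x∉q p q {x} x∈p─q x∈q = <-irrefl refl
  (subst (λ s → ∣ s ∣ < ∣ p ─ q ∣) (p─q─q≡p─q p q)
    (p∩q≢∅⇒∣p─q∣<∣p∣ (p ─ q) q (x , x∈p∩q⁺ (x∈p─q , x∈q))))

disjoint⇒∣p∣+∣q∣≤∣r∣ : p ⊆ r → q ⊆ r → (∀ {x} → x ∈ q → x ∉ p) →
                       ∣ p ∣ + ∣ q ∣ ≤ ∣ r ∣
disjoint⇒∣p∣+∣q∣≤∣r∣ {p = p} {r = r} p⊆r q⊆r q∉p = begin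
  ∣ p ∣ + _              ≤⟨ +-mono-≤
                              (p⊆q⇒∣p∣≤∣q∣ λ x∈p → x∈p∩q⁺ (p⊆r x∈p , x∈p))
                              (p⊆q⇒∣p∣≤∣q∣ λ x∈q → x∈p∧x∉q⇒x∈p─q (q⊆r x∈q) (q∉p x∈q)) ⟩
  ∣ r ∩ p ∣ + ∣ r ─ p ∣  ≡⟨ ∣p∣≡∣p∩q∣+∣p─q∣ r p ⟨
  ∣ r ∣                  ∎
  where open ≤-Reasoning

∪-lub : p ⊆ r → q ⊆ r → p ∪ q ⊆ r
∪-lub p⊆r q⊆r = [ p⊆r , q⊆r ]′ ∘ x∈p∪q⁻ _ _

x∈p⇒⁅x⁆⊆p : ∀ {x} → x ∈ p → ⁅ x ⁆ ⊆ p
x∈p⇒⁅x⁆⊆p {p = p} {x} x∈p y∈⁅x⁆ = subst (_∈ p) (sym (x∈⁅y⁆⇒x≡y x y∈⁅x⁆)) x∈p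

x∉p⇒p⊂p∪⁅x⁆ : ∀ {x} → x ∉ p → p ⊂ p ∪ ⁅ x ⁆
x∉p⇒p⊂p∪⁅x⁆ {x = x} x∉p = p⊆p∪q ⁅ x ⁆ , x , q⊆p∪q _ ⁅ x ⁆ (x∈⁅x⁆ x) , x∉p

x∉p⇒∣p∪⁅x⁆∣≡1+∣p∣ : ∀ (p : Subset n) {x} → x ∉ p → ∣ p ∪ ⁅ x ⁆ ∣ ≡ suc ∣ p ∣
x∉p⇒∣p∪⁅x⁆∣≡1+∣p∣ p {x} x∉p = ≤-antisym
  (≤-trans (∣p∪q∣≤∣p∣+∣q∣ p ⁅ x ⁆)
    (≤-reflexive (trans (cong (∣ p ∣ +_) (∣⁅x⁆∣≡1 x)) (+-comm ∣ p ∣ 1))))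
  (p⊂q⇒∣p∣<∣q∣ (x∉p⇒p⊂p∪⁅x⁆ x∉p))

-- The ground set is a subset of an ambient Fin n, so that matroids with
-- overlapping ground sets can be compared.  Elements outside E play no role.

record Matroid (n : ℕ) : Set₁ where
  field
    E        : Subset n
    Indep    : Pred (Subset n) 0ℓ
    indep?   : Decidable Indep
    indep⊆E  : ∀ {I} → Indep I → I ⊆ E
    ⊥-indep  : Indep ⊥
    ⊆-indep  : ∀ {I J} → I ⊆ J → Indep J → Indep I
    augment  : ∀ {I J} → Indep I → Indep J → ∣ I ∣ < ∣ J ∣ →
               ∃[ e ] e ∈ J × e ∉ I × Indep (I ∪ ⁅ e ⁆)

open Matroid public

Circuit : Matroid n → Pred (Subset n) 0ℓ
Circuit M C = C ⊆ E M × ¬ Indep M C × (∀ {X} → X ⊂ C → Indep M X)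

Loop : Matroid n → Pred (Fin n) 0ℓ
Loop M e = Circuit M ⁅ e ⁆

Loopless : Matroid n → Set
Loopless M = ∀ e → ¬ Loop M e

Parallel : Matroid n → Fin n → Fin n → Set
Parallel M e f = e ≢ f × Circuit M (⁅ e ⁆ ∪ ⁅ f ⁆)

Simple : Matroid n → Set
Simple M = Loopless M × (∀ e f → ¬ Parallel M e f)

Basis : Matroid n → Pred (Subset n) 0ℓ
Basis M B = Indep M B × (∀ {J} → Indep M J → B ⊆ J → J ⊆ B)

module _ (M : Matroid n) where

  extend : ∀ d {I J} → Indep M I → Indep M J → ∣ J ∣ ≡ d + ∣ I ∣ →
           ∃[ K ] Indep M K × I ⊆ K × K ⊆ I ∪ J × ∣ K ∣ ≡ ∣ J ∣
  extend zero    {I} {J} iI iJ eq = I , iI , (λ x → x) , p⊆p∪q J , sym eq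
  extend (suc d) {I} {J} iI iJ eq
    with e , e∈J , e∉I , iI+e ← augment M iI iJ (subst (∣ I ∣ <_) (sym eq) (s≤s (m≤n+m ∣ I ∣ d)))
    with K , iK , I+e⊆K , K⊆ , ∣K∣ ← extend d iI+e iJ
           (trans eq (sym (trans (cong (d +_) (x∉p⇒∣p∪⁅x⁆∣≡1+∣p∣ I e∉I)) (+-suc d ∣ I ∣))))
    = K , iK
    , (λ x∈I → I+e⊆K (p⊆p∪q ⁅ e ⁆ x∈I))
    , (λ x∈K → ∪-lub (∪-lub (p⊆p∪q J) (λ x∈e → q⊆p∪q I J (x∈p⇒⁅x⁆⊆p e∈J x∈e)))
                     (q⊆p∪q I J) (K⊆ x∈K))
    , ∣K∣

  indep⇒∣J∣≤∣B∣ : ∀ {B J} → Basis M B → Indep M J → ∣ J ∣ ≤ ∣ B ∣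
  indep⇒∣J∣≤∣B∣ {B} {J} (iB , max) iJ with ∣ J ∣ ≤? ∣ B ∣
  ... | yes J≤B = J≤B
  ... | no  J≰B with e , _ , e∉B , iB+e ← augment M iB iJ (≰⇒> J≰B) =
    contradiction (max iB+e (p⊆p∪q ⁅ e ⁆) (q⊆p∪q B ⁅ e ⁆ (x∈⁅x⁆ e))) e∉B

  ∃-basis : ∃ (Basis M)
  ∃-basis = grow n ⊥ (⊥-indep M) (m≤m+n n ∣ ⊥ {n} ∣)
    where
    grow : ∀ d I → Indep M I → n ≤ d + ∣ I ∣ → ∃ (Basis M)
    grow d I iI n≤ with any? (λ e → ¬? (e ∈? I) ×-dec indep? M (I ∪ ⁅ e ⁆))
    ... | no ∄e = I , iI , λ {J} iJ I⊆J {x} x∈J → decidable-stable (x ∈? I) λ x∉I →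
      ∄e (x , x∉I , ⊆-indep M (∪-lub I⊆J (x∈p⇒⁅x⁆⊆p x∈J)) iJ)
    grow zero    I iI n≤ | yes (e , e∉I , _) = contradiction
      (≤-trans (p⊂q⇒∣p∣<∣q∣ (x∉p⇒p⊂p∪⁅x⁆ e∉I)) (≤-trans (∣p∣≤n (I ∪ ⁅ e ⁆)) n≤)) (<-irrefl refl)
    grow (suc d) I iI n≤ | yes (e , e∉I , iI+e) = grow d (I ∪ ⁅ e ⁆) iI+e
      (≤-trans n≤ (≤-reflexive (sym (trans (cong (d +_) (x∉p⇒∣p∪⁅x⁆∣≡1+∣p∣ I e∉I)) (+-suc d ∣ I ∣)))))

  rank : ℕ
  rank = ∣ proj₁ ∃-basis ∣

  basis⇒∣B∣≡rank : ∀ {B} → Basis M B → ∣ B ∣ ≡ rank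
  basis⇒∣B∣≡rank bB = ≤-antisym
    (indep⇒∣J∣≤∣B∣ (proj₂ ∃-basis) (proj₁ bB))
    (indep⇒∣J∣≤∣B∣ bB (proj₁ (proj₂ ∃-basis)))

  ∣B∣≡rank⇒basis : ∀ {B} → Indep M B → ∣ B ∣ ≡ rank → Basis M B
  ∣B∣≡rank⇒basis {B} iB eq = iB , λ {J} iJ B⊆J {x} x∈J → decidable-stable (x ∈? B) λ x∉B →
    <⇒≱ (p⊂q⇒∣p∣<∣q∣ (B⊆J , x , x∈J , x∉B))
        (≤-trans (indep⇒∣J∣≤∣B∣ (proj₂ ∃-basis) iJ) (≤-reflexive (sym eq)))

  basis? : Decidable (Basis M)
  basis? B = map′ (λ (iB , eq) → ∣B∣≡rank⇒basis iB eq)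
                  (λ bB → proj₁ bB , basis⇒∣B∣≡rank bB)
                  (indep? M B ×-dec (∣ B ∣ ≟ rank))

  -- The bases of the dual are the complements E ─ B of the bases B.
  dual : Matroid n
  dual = record
    { E        = E M
    ; Indep    = CoIndep
    ; indep?   = λ I → anySubset? λ B → basis? B ×-dec (I ⊆? E M ─ B)
    ; indep⊆E  = λ (B , _ , I⊆) x∈I → p─q⊆p (E M) B (I⊆ x∈I)
    ; ⊥-indep  = let (B , bB) = ∃-basis in B , bB , ⊥⊆
    ; ⊆-indep  = λ I⊆J (B , bB , J⊆) → B , bB , λ x∈I → J⊆ (I⊆J x∈I)
    ; augment  = coaugment
    }
    where
    CoIndep : Pred (Subset n) 0ℓ
    CoIndep I = ∃[ B ] Basis M B × I ⊆ E M ─ B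

    coaugment : ∀ {I J} → CoIndep I → CoIndep J → ∣ I ∣ < ∣ J ∣ →
                ∃[ e ] e ∈ J × e ∉ I × CoIndep (I ∪ ⁅ e ⁆)
    coaugment {I} {J} (B₁ , bB₁ , I⊆) (B₂ , bB₂ , J⊆) ∣I∣<∣J∣
      with B′ , iB′ , K⊆B′ , B′⊆ , ∣B′∣ ←
             extend (∣ B₁ ∣ ∸ ∣ B₂ ─ I ∣)
               (⊆-indep M (p─q⊆p B₂ I) (proj₁ bB₂)) (proj₁ bB₁)
               (sym (m∸n+n≡m (indep⇒∣J∣≤∣B∣ bB₁ (⊆-indep M (p─q⊆p B₂ I) (proj₁ bB₂)))))
      with any? (λ e → (e ∈? J) ×-dec ¬? (e ∈? I) ×-dec ¬? (e ∈? B′))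
    ... | yes (e , e∈J , e∉I , e∉B′) =
      e , e∈J , e∉I , B′
        , ∣B∣≡rank⇒basis iB′ (trans ∣B′∣ (basis⇒∣B∣≡rank bB₁))
        , ∪-lub
            (λ x∈I → x∈p∧x∉q⇒x∈p─q (p─q⊆p (E M) B₁ (I⊆ x∈I)) λ x∈B′ →
              [ (λ x∈K → x∈p─q⇒x∉q B₂ I x∈K x∈I)
              , x∈p─q⇒x∉q (E M) B₁ (I⊆ x∈I) ]′ (x∈p∪q⁻ (B₂ ─ I) B₁ (B′⊆ x∈B′)))
            (x∈p⇒⁅x⁆⊆p (x∈p∧x∉q⇒x∈p─q (p─q⊆p (E M) B₂ (J⊆ e∈J)) e∉B′))
    ... | no ∄e = contradiction ∣I∣<∣J∣ (≤⇒≯ ∣J∣≤∣I∣)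
      where
      open ≤-Reasoning

      J─I⊆B′ : J ─ I ⊆ B′
      J─I⊆B′ {x} x∈ = decidable-stable (x ∈? B′) λ x∉B′ →
        ∄e (x , p─q⊆p J I x∈ , x∈p─q⇒x∉q J I x∈ , x∉B′)

      ∣J─I∣≤∣B₂∩I∣ : ∣ J ─ I ∣ ≤ ∣ B₂ ∩ I ∣
      ∣J─I∣≤∣B₂∩I∣ = +-cancelʳ-≤ (∣ B₂ ─ I ∣) (∣ J ─ I ∣) (∣ B₂ ∩ I ∣) (begin
        ∣ J ─ I ∣ + ∣ B₂ ─ I ∣   ≤⟨ disjoint⇒∣p∣+∣q∣≤∣r∣ J─I⊆B′ K⊆B′ (λ x∈K x∈J─I →
                                     x∈p─q⇒x∉q (E M) B₂ (J⊆ (p─q⊆p J I x∈J─I)) (p─q⊆p B₂ I x∈K)) ⟩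
        ∣ B′ ∣                   ≡⟨ trans ∣B′∣ (trans (basis⇒∣B∣≡rank bB₁) (sym (basis⇒∣B∣≡rank bB₂))) ⟩
        ∣ B₂ ∣                   ≡⟨ ∣p∣≡∣p∩q∣+∣p─q∣ B₂ I ⟩
        ∣ B₂ ∩ I ∣ + ∣ B₂ ─ I ∣  ∎)

      ∣J∣≤∣I∣ : ∣ J ∣ ≤ ∣ I ∣
      ∣J∣≤∣I∣ = begin
        ∣ J ∣                   ≡⟨ ∣p∣≡∣p∩q∣+∣p─q∣ J I ⟩
        ∣ J ∩ I ∣ + ∣ J ─ I ∣   ≤⟨ +-monoʳ-≤ ∣ J ∩ I ∣ ∣J─I∣≤∣B₂∩I∣ ⟩
        ∣ J ∩ I ∣ + ∣ B₂ ∩ I ∣  ≤⟨ disjoint⇒∣p∣+∣q∣≤∣r∣ (p∩q⊆q J I) (p∩q⊆q B₂ I) (λ x∈B₂∩I x∈J∩I →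
                                     x∈p─q⇒x∉q (E M) B₂ (J⊆ (p∩q⊆p J I x∈J∩I)) (p∩q⊆p B₂ I x∈B₂∩I)) ⟩
        ∣ I ∣                   ∎

  -- The restriction M | X when X ⊆ E (elements of X outside E become loops).
  _↾_ : Subset n → Matroid n
  _↾_ X = record
    { E        = X
    ; Indep    = λ I → I ⊆ X × Indep M I
    ; indep?   = λ I → (I ⊆? X) ×-dec indep? M I
    ; indep⊆E  = proj₁
    ; ⊥-indep  = ⊥⊆ , ⊥-indep M
    ; ⊆-indep  = λ I⊆J (J⊆X , iJ) → (λ x∈I → J⊆X (I⊆J x∈I)) , ⊆-indep M I⊆J iJ
    ; augment  = λ (I⊆X , iI) (J⊆X , iJ) lt →
        let (e , e∈J , e∉I , iI+e) = augment M iI iJ lt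
        in e , e∈J , e∉I , ∪-lub I⊆X (x∈p⇒⁅x⁆⊆p (J⊆X e∈J)) , iI+e
    }

Coloop : Matroid n → Pred (Fin n) 0ℓ
Coloop M = Loop (dual M)

Cocircuit : Matroid n → Pred (Subset n) 0ℓ
Cocircuit M = Circuit (dual M)

-- A relation rather than a function, since a matroid of rank 0 has no
-- cocircuits and hence no cogirth.
IsCogirth : Matroid n → ℕ → Set
IsCogirth M g = (∃[ C ] Cocircuit M C × ∣ C ∣ ≡ g) × (∀ {C} → Cocircuit M C → g ≤ ∣ C ∣)

record MinimallyDegenerate (k : ℕ) (M : Matroid n) : Set where
  field
    2≤k      : 2 ≤ k
    nonempty : Nonempty (E M)
    loopless : Loopless M
    cogirth  : IsCogirth M k
    minimal  : ∀ {X} → Nonempty X → X ⊂ E M →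
               ∃[ g ] IsCogirth (M ↾ X) g × g ≤ k ∸ 1

U : (r n : ℕ) → Matroid n
U r n = record
  { E        = ⊤
  ; Indep    = λ I → ∣ I ∣ ≤ r
  ; indep?   = λ I → ∣ I ∣ ≤? r
  ; indep⊆E  = λ _ → ⊆⊤
  ; ⊥-indep  = ≤-trans (≤-reflexive (∣⊥∣≡0 n)) z≤n
  ; ⊆-indep  = λ I⊆J → ≤-trans (p⊆q⇒∣p∣≤∣q∣ I⊆J)
  ; augment  = uniform-augment
  }
  where
  uniform-augment : ∀ {I J : Subset n} → ∣ I ∣ ≤ r → ∣ J ∣ ≤ r → ∣ I ∣ < ∣ J ∣ →
                    ∃[ e ] e ∈ J × e ∉ I × ∣ I ∪ ⁅ e ⁆ ∣ ≤ r
  uniform-augment {I} {J} _ J≤r I<J with any? (λ e → (e ∈? J) ×-dec ¬? (e ∈? I))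
  ... | yes (e , e∈J , e∉I) = e , e∈J , e∉I ,
    ≤-trans (≤-reflexive (x∉p⇒∣p∪⁅x⁆∣≡1+∣p∣ I e∉I)) (≤-trans I<J J≤r)
  ... | no ∄e = contradiction I<J (≤⇒≯ (p⊆q⇒∣p∣≤∣q∣ λ {x} x∈J →
    decidable-stable (x ∈? I) λ x∉I → ∄e (x , x∈J , x∉I)))

infix 4 _≅_

-- The hypothesis of indep⇔ says that Y is the image of X under the bijection.
-- Membership proofs are unique, so the Σ-types below really are the ground sets.
record _≅_ (M : Matroid m) (N : Matroid n) : Set where
  field
    bijection : ∃ (_∈ E M) ↔ ∃ (_∈ E N)
    indep⇔    : ∀ {X Y} → X ⊆ E M → Y ⊆ E N →
                (∀ e → proj₁ e ∈ X ⇔ proj₁ (Inverse.to bijection e) ∈ Y) →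
                Indep M X ⇔ Indep N Y

data TwoSumCircuit (M₁ M₂ : Matroid n) (p : Fin n) : Pred (Subset n) 0ℓ where
  left  : ∀ {C} → Circuit M₁ C → p ∉ C → TwoSumCircuit M₁ M₂ p C
  right : ∀ {C} → Circuit M₂ C → p ∉ C → TwoSumCircuit M₁ M₂ p C
  join  : ∀ {C₁ C₂} → Circuit M₁ C₁ → p ∈ C₁ → Circuit M₂ C₂ → p ∈ C₂ →
          TwoSumCircuit M₁ M₂ p ((C₁ ∪ C₂) - p)

-- M is the 2-sum of M₁ and M₂ at basepoint p: a matroid is determined by its
-- ground set and its circuits.
record IsTwoSum (M₁ M₂ : Matroid n) (p : Fin n) (M : Matroid n) : Set where
  field
    meet      : E M₁ ∩ E M₂ ≡ ⁅ p ⁆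
    size₁     : 3 ≤ ∣ E M₁ ∣
    size₂     : 3 ≤ ∣ E M₂ ∣
    ¬loop₁    : ¬ Loop M₁ p
    ¬loop₂    : ¬ Loop M₂ p
    ¬coloop₁  : ¬ Coloop M₁ p
    ¬coloop₂  : ¬ Coloop M₂ p
    ground    : E M ≡ (E M₁ ∪ E M₂) - p
    circuits  : ∀ C → Circuit M C ⇔ TwoSumCircuit M₁ M₂ p C

infix 4 _≅_⊕₂_

-- M is isomorphic to a 2-sum of a copy of A and a copy of B that share exactly
-- one element.  The choice of basepoint is left free; for uniform A and B it
-- does not matter.
_≅_⊕₂_ : ∀ {l} → Matroid l → Matroid m → Matroid n → Set₁
M ≅ A ⊕₂ B = ∃[ a ] ∃[ M₁ ] ∃[ M₂ ] ∃[ p ] ∃[ S ]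
  M₁ ≅ A × M₂ ≅ B × IsTwoSum {a} M₁ M₂ p S × M ≅ S

{-# OPTIONS --safe #-}
-- Write q = k − 1 and call X ⊆ E tight if |X| = q (r(X) − 1) + 1.  Deleting small
-- cocircuits one after the other bounds every proper nonempty restriction by its
-- tight size; applied to E − e this is the upper bound on |E|.
--
-- If the bound is attained, then every E − e is tight, hence every element is
-- avoided by a tight hyperplane, and every tight X ≠ E of rank at least 2 contains
-- a tight set of rank one less.  Let r(M) ≥ 3.  By submodularity any two tight
-- hyperplanes cover all but at most one element.  As q ≥ 3, this forces the
-- complement of each tight line L to be a tight hyperplane (two hyperplanes, each
-- meeting L in at most one point, would miss two points of L).  Consequently a
-- descending chain of tight sets starting above L loses L only when it reaches L,
-- so a tight proper set contains at most one tight line.  Now E ─ L contains a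
-- tight line L′, and a tight hyperplane avoiding a point outside L ∪ L′ would
-- contain both; hence E = L ∪ L′ and r(M) = 3.
module Submission where

open import Defs
open import Level using (0ℓ)
open import Data.Bool using (true; false)
open import Data.Bool.Properties using () renaming (_≟_ to _≟ᵇ_)
open import Data.Empty using (⊥-elim)
open import Data.Fin using (Fin; zero; suc)
open import Data.Fin.Properties using () renaming (suc-injective to sucᶠ-injective)
open import Data.Fin.Subset
open import Data.Fin.Subset.Properties
open import Data.Nat using (ℕ; zero; suc; _+_; _*_; _∸_; _≤_; _<_; z≤n; s≤s; s≤s⁻¹; _<?_; _≤?_)
open import Data.Nat.Properties
open import Data.Nat.Solver using (module +-*-Solver)
open import Data.Product using (∃; ∃-syntax; _×_; _,_; proj₁; proj₂)
open import Data.Sum using (_⊎_; inj₁; inj₂; [_,_]′; map)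
open import Data.Vec using ([]; _∷_; here; there; head; tail; tabulate)
open import Data.Vec.Properties using (lookup∘tabulate; []=⇒lookup; lookup⇒[]=)
open import Data.Vec.Properties.WithK using ([]=-irrelevant)
open import Function using (_∘_; _↔_; _⇔_; mk⇔; mk↔ₛ′; Inverse; Equivalence)
open import Function.Properties.Inverse using (↔-sym; ↔-trans)
open import Relation.Binary.PropositionalEquality
open import Relation.Nullary using (¬_; yes; no; contradiction; does)
open import Relation.Nullary.Decidable using (decidable-stable; dec-true; _×-dec_)
open import Relation.Unary using (Pred; Decidable)

open +-*-Solver using (solve; _:+_; _:*_; _:=_; con)

private
  variable
    m n : ℕ
    p q s : Subset n
    t : Subset m

-- Counting in finite subsets

∣p∪q∣+∣p∩q∣≡∣p∣+∣q∣ : ∀ (p q : Subset n) → ∣ p ∪ q ∣ + ∣ p ∩ q ∣ ≡ ∣ p ∣ + ∣ q ∣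
∣p∪q∣+∣p∩q∣≡∣p∣+∣q∣ []          []          = refl
∣p∪q∣+∣p∩q∣≡∣p∣+∣q∣ (true  ∷ p) (true  ∷ q) = cong suc (trans (+-suc _ _)
  (trans (cong suc (∣p∪q∣+∣p∩q∣≡∣p∣+∣q∣ p q)) (sym (+-suc _ _))))
∣p∪q∣+∣p∩q∣≡∣p∣+∣q∣ (true  ∷ p) (false ∷ q) = cong suc (∣p∪q∣+∣p∩q∣≡∣p∣+∣q∣ p q)
∣p∪q∣+∣p∩q∣≡∣p∣+∣q∣ (false ∷ p) (true  ∷ q) =
  trans (cong suc (∣p∪q∣+∣p∩q∣≡∣p∣+∣q∣ p q)) (sym (+-suc _ _))
∣p∪q∣+∣p∩q∣≡∣p∣+∣q∣ (false ∷ p) (false ∷ q) = ∣p∪q∣+∣p∩q∣≡∣p∣+∣q∣ p q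

p⊆q∧∣q∣≤∣p∣⇒q⊆p : p ⊆ q → ∣ q ∣ ≤ ∣ p ∣ → q ⊆ p
p⊆q∧∣q∣≤∣p∣⇒q⊆p {p = p} p⊆q ∣q∣≤∣p∣ {x} x∈q = decidable-stable (x ∈? p) λ x∉p →
  <⇒≱ (p⊂q⇒∣p∣<∣q∣ (p⊆q , x , x∈q , x∉p)) ∣q∣≤∣p∣

subset-of-size : ∀ s (p : Subset n) → s ≤ ∣ p ∣ → ∃[ t ] t ⊆ p × ∣ t ∣ ≡ s
subset-of-size {n} zero p _ = ⊥ , ⊥⊆ , ∣⊥∣≡0 n
subset-of-size (suc s) (true ∷ p) (s≤s s≤∣p∣) with t , t⊆p , eq ← subset-of-size s p s≤∣p∣ =
  true ∷ t , in⊆in t⊆p , cong suc eq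
subset-of-size (suc s) (false ∷ p) s<∣p∣ with t , t⊆p , eq ← subset-of-size (suc s) p s<∣p∣ =
  false ∷ t , out⊆ t⊆p , eq

x∈p⇒1≤∣p∣ : ∀ {x} → x ∈ p → 1 ≤ ∣ p ∣
x∈p⇒1≤∣p∣ {x = x} x∈p = subst (_≤ _) (∣⁅x⁆∣≡1 x) (p⊆q⇒∣p∣≤∣q∣ (x∈p⇒⁅x⁆⊆p x∈p))

Empty⇒∣p∣≡0 : Empty p → ∣ p ∣ ≡ 0
Empty⇒∣p∣≡0 {n} ∄p = trans (cong ∣_∣ (Empty-unique ∄p)) (∣⊥∣≡0 n)

∣p∣≤∣p─q∣+∣q∣ : ∀ (p q : Subset n) → ∣ p ∣ ≤ ∣ p ─ q ∣ + ∣ q ∣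
∣p∣≤∣p─q∣+∣q∣ p q = begin
  ∣ p ∣                  ≡⟨ ∣p∣≡∣p∩q∣+∣p─q∣ p q ⟩
  ∣ p ∩ q ∣ + ∣ p ─ q ∣  ≤⟨ +-monoˡ-≤ _ (∣p∩q∣≤∣q∣ p q) ⟩
  ∣ q ∣ + ∣ p ─ q ∣      ≡⟨ +-comm ∣ q ∣ _ ⟩
  ∣ p ─ q ∣ + ∣ q ∣      ∎
  where open ≤-Reasoning

q⊆p⇒∣p∣≡∣p─q∣+∣q∣ : q ⊆ p → ∣ p ∣ ≡ ∣ p ─ q ∣ + ∣ q ∣
q⊆p⇒∣p∣≡∣p─q∣+∣q∣ {q = q} {p = p} q⊆p = begin
  ∣ p ∣                  ≡⟨ ∣p∣≡∣p∩q∣+∣p─q∣ p q ⟩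
  ∣ p ∩ q ∣ + ∣ p ─ q ∣  ≡⟨ cong (λ s → ∣ s ∣ + ∣ p ─ q ∣)
                             (⊆-antisym (p∩q⊆q p q) λ x∈q → x∈p∩q⁺ (q⊆p x∈q , x∈q)) ⟩
  ∣ q ∣ + ∣ p ─ q ∣      ≡⟨ +-comm ∣ q ∣ _ ⟩
  ∣ p ─ q ∣ + ∣ q ∣      ∎
  where open ≡-Reasoning

⁅x⁆∪⁅y⁆⊆p : ∀ {x y} → x ∈ p → y ∈ p → ⁅ x ⁆ ∪ ⁅ y ⁆ ⊆ p
⁅x⁆∪⁅y⁆⊆p x∈p y∈p = ∪-lub (x∈p⇒⁅x⁆⊆p x∈p) (x∈p⇒⁅x⁆⊆p y∈p)

∣⁅x⁆∪⁅y⁆∣≡2 : ∀ {x y : Fin n} → x ≢ y → ∣ ⁅ x ⁆ ∪ ⁅ y ⁆ ∣ ≡ 2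
∣⁅x⁆∪⁅y⁆∣≡2 {x = x} {y} x≢y = trans
  (x∉p⇒∣p∪⁅x⁆∣≡1+∣p∣ ⁅ x ⁆ (x≢y ∘ sym ∘ x∈⁅y⁆⇒x≡y x)) (cong suc (∣⁅x⁆∣≡1 x))

p⊆q∧q⊈p⇒p⊂q : p ⊆ q → q ⊈ p → p ⊂ q
p⊆q∧q⊈p⇒p⊂q {p = p} {q} p⊆q q⊈p with nonempty? (q ─ p)
... | yes (x , x∈) = p⊆q , x , p─q⊆p q p x∈ , x∈p─q⇒x∉q q p x∈
... | no  ∄x = ⊥-elim (q⊈p λ {x} x∈q → decidable-stable (x ∈? p) λ x∉p →
                 ∄x (x , x∈p∧x∉q⇒x∈p─q x∈q x∉p))

p⊆q∪s⇒p⊆p∩q∪p∩s : p ⊆ q ∪ s → p ⊆ (p ∩ q) ∪ (p ∩ s)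
p⊆q∪s⇒p⊆p∩q∪p∩s {q = q} {s = s} p⊆q∪s x∈p =
  x∈p∪q⁺ (map (λ x∈q → x∈p∩q⁺ (x∈p , x∈q)) (λ x∈s → x∈p∩q⁺ (x∈p , x∈s)) (x∈p∪q⁻ q s (p⊆q∪s x∈p)))

p⊆q∪s⇒∣p∣≤∣p∩q∣+∣p∩s∣ : p ⊆ q ∪ s → ∣ p ∣ ≤ ∣ p ∩ q ∣ + ∣ p ∩ s ∣
p⊆q∪s⇒∣p∣≤∣p∩q∣+∣p∩s∣ {p = p} {q} {s} p⊆q∪s = ≤-trans
  (p⊆q⇒∣p∣≤∣q∣ (p⊆q∪s⇒p⊆p∩q∪p∩s p⊆q∪s)) (∣p∪q∣≤∣p∣+∣q∣ (p ∩ q) (p ∩ s))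

-- The rank function of restrictions

module Rank (M : Matroid n) where

  private
    variable
      C I X Y : Subset n

  -- Opaque, since otherwise with-abstraction normalises the search for a basis.
  opaque
    r : Subset n → ℕ
    r X = rank (M ↾ X)

    indep⇒∣I∣≤r : Indep M I → I ⊆ X → ∣ I ∣ ≤ r X
    indep⇒∣I∣≤r {X = X} iI I⊆X = indep⇒∣J∣≤∣B∣ (M ↾ X) (proj₂ (∃-basis (M ↾ X))) (I⊆X , iI)

    extend-to-basis : Indep M I → I ⊆ X → ∃[ J ] Indep M J × I ⊆ J × J ⊆ X × ∣ J ∣ ≡ r X
    extend-to-basis {I} {X} iI I⊆X
      with B⊆X , iB ← proj₁ (proj₂ (∃-basis (M ↾ X)))
      with J , iJ , I⊆J , J⊆ , ∣J∣ ← extend M (r X ∸ ∣ I ∣) iI iB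
             (sym (m∸n+n≡m (indep⇒∣I∣≤r iI I⊆X)))
      = J , iJ , I⊆J , (λ x∈J → ∪-lub I⊆X B⊆X (J⊆ x∈J)) , ∣J∣

  ∃-r-basis : ∀ X → ∃[ J ] Indep M J × J ⊆ X × ∣ J ∣ ≡ r X
  ∃-r-basis X = let (J , iJ , _ , J⊆X , ∣J∣) = extend-to-basis (⊥-indep M) ⊥⊆ in J , iJ , J⊆X , ∣J∣

  r≤∣X∣ : ∀ X → r X ≤ ∣ X ∣
  r≤∣X∣ X with J , _ , J⊆X , ∣J∣ ← ∃-r-basis X = subst (_≤ ∣ X ∣) ∣J∣ (p⊆q⇒∣p∣≤∣q∣ J⊆X)

  1≤r⇒nonempty : 1 ≤ r X → Nonempty X
  1≤r⇒nonempty {X} 1≤r with nonempty? X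
  ... | yes X≠∅ = X≠∅
  ... | no  X=∅ =
    contradiction (≤-trans 1≤r (≤-trans (r≤∣X∣ X) (≤-reflexive (Empty⇒∣p∣≡0 X=∅)))) λ ()

  r-mono : X ⊆ Y → r X ≤ r Y
  r-mono {X} X⊆Y with J , iJ , J⊆X , ∣J∣ ← ∃-r-basis X =
    subst (_≤ _) ∣J∣ (indep⇒∣I∣≤r iJ (λ x∈J → X⊆Y (J⊆X x∈J)))

  -- A basis `I` of `X ∩ Y` extends to a basis `J` of `X ∪ Y`. The parts of `J` in `X` and in `Y`
  -- are independent, cover `J` and overlap in at least `I`.
  r-submodular : ∀ X Y → r (X ∪ Y) + r (X ∩ Y) ≤ r X + r Y
  r-submodular X Y
    with I , iI , I⊆ , ∣I∣ ← ∃-r-basis (X ∩ Y)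
    with J , iJ , I⊆J , J⊆ , ∣J∣ ← extend-to-basis {X = X ∪ Y} iI
           (λ x∈I → p⊆p∪q Y (p∩q⊆p X Y (I⊆ x∈I)))
    = begin
    r (X ∪ Y) + r (X ∩ Y)                              ≡⟨ cong₂ _+_ ∣J∣ ∣I∣ ⟨
    ∣ J ∣ + ∣ I ∣                                      ≤⟨ +-mono-≤ (p⊆q⇒∣p∣≤∣q∣ J⊆∪) (p⊆q⇒∣p∣≤∣q∣ I⊆∩) ⟩
    ∣ (J ∩ X) ∪ (J ∩ Y) ∣ + ∣ (J ∩ X) ∩ (J ∩ Y) ∣      ≡⟨ ∣p∪q∣+∣p∩q∣≡∣p∣+∣q∣ (J ∩ X) (J ∩ Y) ⟩
    ∣ J ∩ X ∣ + ∣ J ∩ Y ∣                              ≤⟨ +-mono-≤ (∣J∩Z∣≤r X) (∣J∩Z∣≤r Y) ⟩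
    r X + r Y                                          ∎
    where
    open ≤-Reasoning

    ∣J∩Z∣≤r : ∀ Z → ∣ J ∩ Z ∣ ≤ r Z
    ∣J∩Z∣≤r Z = indep⇒∣I∣≤r (⊆-indep M (p∩q⊆p J Z) iJ) (p∩q⊆q J Z)

    J⊆∪ : J ⊆ (J ∩ X) ∪ (J ∩ Y)
    J⊆∪ = p⊆q∪s⇒p⊆p∩q∪p∩s J⊆

    I⊆∩ : I ⊆ (J ∩ X) ∩ (J ∩ Y)
    I⊆∩ x∈I = x∈p∩q⁺ ( x∈p∩q⁺ (I⊆J x∈I , p∩q⊆p X Y (I⊆ x∈I))
                     , x∈p∩q⁺ (I⊆J x∈I , p∩q⊆q X Y (I⊆ x∈I)))

  r-E≡rank : r (E M) ≡ rank M
  r-E≡rank with J , iJ , _ , ∣J∣ ← ∃-r-basis (E M) = ≤-antisym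
    (subst (_≤ rank M) ∣J∣ (indep⇒∣J∣≤∣B∣ M (proj₂ (∃-basis M)) iJ))
    (indep⇒∣I∣≤r iB (indep⊆E M iB))
    where
    iB : Indep M (proj₁ (∃-basis M))
    iB = proj₁ (proj₂ (∃-basis M))

  ∣I∣≤r⇒indep : ∣ I ∣ ≤ r I → Indep M I
  ∣I∣≤r⇒indep {I} ∣I∣≤r with J , iJ , J⊆I , ∣J∣ ← ∃-r-basis I =
    ⊆-indep M (p⊆q∧∣q∣≤∣p∣⇒q⊆p J⊆I (≤-trans ∣I∣≤r (≤-reflexive (sym ∣J∣)))) iJ

  opaque
    unfolding r

    -- If the rank did not drop, a basis of `X ─ C` would be a basis of `M ↾ X` disjoint from `C`,
    -- so `C` would be coindependent.
    cocircuit⇒r< : Cocircuit (M ↾ X) C → r (X ─ C) < r X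
    cocircuit⇒r< {X} {C} (C⊆X , ¬coindep , _) with r (X ─ C) <? r X
    ... | yes r< = r<
    ... | no  r≮ with J , iJ , J⊆ , ∣J∣ ← ∃-r-basis (X ─ C) = ⊥-elim (¬coindep
      ( J
      , ∣B∣≡rank⇒basis (M ↾ X) (J⊆X , iJ)
          (≤-antisym (indep⇒∣I∣≤r iJ J⊆X) (≤-trans (≮⇒≥ r≮) (≤-reflexive (sym ∣J∣))))
      , λ x∈C → x∈p∧x∉q⇒x∈p─q (C⊆X x∈C) λ x∈J → x∈p─q⇒x∉q X C (J⊆ x∈J) x∈C ))
      where
      J⊆X : J ⊆ X
      J⊆X x∈J = p─q⊆p X C (J⊆ x∈J)

-- Small sets in simple matroids

module SimpleMatroid (M : Matroid n) (simple : Simple M) where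

  open Rank M

  private
    variable
      I X : Subset n

  singleton-indep : ∀ {e} → e ∈ E M → Indep M ⁅ e ⁆
  singleton-indep {e} e∈E = decidable-stable (indep? M ⁅ e ⁆) λ ¬i → proj₁ simple e
    ( x∈p⇒⁅x⁆⊆p e∈E , ¬i
    , λ {X} (X⊆e , y , y∈e , y∉X) → subst (Indep M) (sym (Empty-unique λ (x , x∈X) →
        y∉X (subst (_∈ X) (trans (x∈⁅y⁆⇒x≡y e (X⊆e x∈X)) (sym (x∈⁅y⁆⇒x≡y e y∈e))) x∈X)))
        (⊥-indep M))

  pair-indep : ∀ {e f} → e ∈ E M → f ∈ E M → e ≢ f → Indep M (⁅ e ⁆ ∪ ⁅ f ⁆)
  pair-indep {e} {f} e∈E f∈E e≢f = decidable-stable (indep? M _) λ ¬i → proj₂ simple e f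
    (e≢f , ⁅x⁆∪⁅y⁆⊆p e∈E f∈E , ¬i , proper)
    where
    proper : ∀ {X} → X ⊂ ⁅ e ⁆ ∪ ⁅ f ⁆ → Indep M X
    proper {X} (X⊆ , y , y∈ , y∉X) with x∈p∪q⁻ ⁅ e ⁆ ⁅ f ⁆ y∈
    ... | inj₁ y∈e = ⊆-indep M (λ {x} x∈X → [ (λ x∈e → contradiction (subst (_∈ X)
                       (trans (x∈⁅y⁆⇒x≡y e x∈e) (sym (x∈⁅y⁆⇒x≡y e y∈e))) x∈X) y∉X) , (λ z → z) ]′
                       (x∈p∪q⁻ ⁅ e ⁆ ⁅ f ⁆ (X⊆ x∈X))) (singleton-indep f∈E)
    ... | inj₂ y∈f = ⊆-indep M (λ {x} x∈X → [ (λ z → z) , (λ x∈f → contradiction (subst (_∈ X)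
                       (trans (x∈⁅y⁆⇒x≡y f x∈f) (sym (x∈⁅y⁆⇒x≡y f y∈f))) x∈X) y∉X) ]′
                       (x∈p∪q⁻ ⁅ e ⁆ ⁅ f ⁆ (X⊆ x∈X))) (singleton-indep e∈E)

  ∣I∣≤2⇒indep : I ⊆ E M → ∣ I ∣ ≤ 2 → Indep M I
  ∣I∣≤2⇒indep {I} I⊆E ∣I∣≤2 with nonempty? I
  ... | no ∄I = subst (Indep M) (sym (Empty-unique ∄I)) (⊥-indep M)
  ... | yes (x , x∈I) with nonempty? (I - x)
  ...   | no ∄ = ⊆-indep M (λ {y} y∈I → decidable-stable (y ∈? ⁅ x ⁆) λ y∉ →
                   ∄ (y , x∈p∧x∉q⇒x∈p─q y∈I y∉)) (singleton-indep (I⊆E x∈I))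
  ...   | yes (y , y∈) = ⊆-indep M
            (p⊆q∧∣q∣≤∣p∣⇒q⊆p (⁅x⁆∪⁅y⁆⊆p x∈I y∈I)
              (≤-trans ∣I∣≤2 (≤-reflexive (sym (∣⁅x⁆∪⁅y⁆∣≡2 x≢y)))))
            (pair-indep (I⊆E x∈I) (I⊆E y∈I) x≢y)
    where
    y∈I : y ∈ I
    y∈I = p─q⊆p I ⁅ x ⁆ y∈

    x≢y : x ≢ y
    x≢y x≡y = x∈p─q⇒x∉q I ⁅ x ⁆ y∈ (subst (_∈ ⁅ x ⁆) x≡y (x∈⁅x⁆ x))

  s≤∣X∣⇒s≤r : ∀ {s} → s ≤ 2 → X ⊆ E M → s ≤ ∣ X ∣ → s ≤ r X
  s≤∣X∣⇒s≤r {X} {s} s≤2 X⊆E s≤∣X∣ with I , I⊆X , ∣I∣ ← subset-of-size s X s≤∣X∣ =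
    subst (_≤ r X) ∣I∣ (indep⇒∣I∣≤r (∣I∣≤2⇒indep (λ x∈I → X⊆E (I⊆X x∈I))
      (subst (_≤ 2) (sym ∣I∣) s≤2)) I⊆X)

  r<2⇒∣X∣<2 : X ⊆ E M → r X < 2 → ∣ X ∣ < 2
  r<2⇒∣X∣<2 X⊆E r<2 = ≰⇒> λ 2≤∣X∣ → <⇒≱ r<2 (s≤∣X∣⇒s≤r ≤-refl X⊆E 2≤∣X∣)

-- Density of proper restrictions and tight sets

≤-by-cancellation : ∀ {u v x y} → u ≤ v → x + v ≡ y + u → x ≤ y
≤-by-cancellation {u} {v} {x} {y} u≤v eq = +-cancelʳ-≤ u x y (begin
  x + u  ≤⟨ +-monoʳ-≤ x u≤v ⟩
  x + v  ≡⟨ eq ⟩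
  y + u  ∎)
  where open ≤-Reasoning

module Density (q : ℕ) (3≤q : 3 ≤ q) (M : Matroid n) (simple : Simple M)
  (small-cocircuit : ∀ {X} → Nonempty X → X ⊂ E M →
                     ∃[ C ] Cocircuit (M ↾ X) C × ∣ C ∣ ≤ q)
  where

  open Rank M
  open SimpleMatroid M simple

  private
    variable
      H H′ L L′ X Y Z : Subset n

  opaque
    1≤q : 1 ≤ q
    1≤q = ≤-trans (s≤s z≤n) 3≤q

    q+q≡q*2 : q + q ≡ q * 2
    q+q≡q*2 = solve 1 (λ q → q :+ q := q :* con 2) refl q

    1+qa+q≡1+q[1+a] : ∀ a → suc (q * a) + q ≡ suc (q * suc a)
    1+qa+q≡1+q[1+a] a = solve 2 (λ q a → con 1 :+ q :* a :+ q := con 1 :+ q :* (con 1 :+ a)) refl q a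

    r<⇒⊈ : r Y < r X → X ⊈ Y
    r<⇒⊈ rY<rX X⊆Y = <⇒≱ rY<rX (r-mono X⊆Y)

    -- Induction on a bound `d` for the size. Removing a cocircuit costs at most `q` elements and at
    -- least one unit of rank, so the bound passes from `X ─ C` to `X`. If nothing remains, then
    -- `∣ X ∣ ≤ q`, which suffices in rank at least 2; in rank at most 1 simplicity leaves a single
    -- element. The term `q` stands on the left to avoid truncated subtraction.
    sparse′ : ∀ d {X} → ∣ X ∣ ≤ d → Nonempty X → X ⊂ E M → ∣ X ∣ + q ≤ suc (q * r X)
    sparse′ zero ∣X∣≤0 (x , x∈X) _ = contradiction (≤-trans (x∈p⇒1≤∣p∣ x∈X) ∣X∣≤0) λ ()
    sparse′ (suc d) {X} ∣X∣≤d (x , x∈X) X⊂E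
      with C , C* , ∣C∣≤q ← small-cocircuit (x , x∈X) X⊂E
      with nonempty? (X ─ C)
    ... | yes Y≠∅ = begin
      ∣ X ∣ + q                  ≤⟨ +-monoˡ-≤ q (≤-trans (∣p∣≤∣p─q∣+∣q∣ X C) (+-monoʳ-≤ _ ∣C∣≤q)) ⟩
      ∣ X ─ C ∣ + q + q          ≤⟨ +-monoˡ-≤ q (sparse′ d (s≤s⁻¹ (≤-trans ∣Y∣<∣X∣ ∣X∣≤d)) Y≠∅
                                      (⊆-⊂-trans (p─q⊆p X C) X⊂E)) ⟩
      suc (q * r (X ─ C) + q)    ≡⟨ 1+qa+q≡1+q[1+a] _ ⟩
      suc (q * suc (r (X ─ C)))  ≤⟨ s≤s (*-monoʳ-≤ q (cocircuit⇒r< C*)) ⟩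
      suc (q * r X)              ∎
      where
      open ≤-Reasoning

      ∣Y∣<∣X∣ : ∣ X ─ C ∣ < ∣ X ∣
      ∣Y∣<∣X∣ = p⊂q⇒∣p∣<∣q∣ (p⊆q∧q⊈p⇒p⊂q (p─q⊆p X C) (r<⇒⊈ (cocircuit⇒r< C*)))
    ... | no Y=∅ with 2 ≤? r X
    ...   | yes 2≤r = begin
      ∣ X ∣ + q              ≤⟨ +-monoˡ-≤ q (∣p∣≤∣p─q∣+∣q∣ X C) ⟩
      ∣ X ─ C ∣ + ∣ C ∣ + q  ≡⟨ cong (λ z → z + ∣ C ∣ + q) (Empty⇒∣p∣≡0 Y=∅) ⟩
      ∣ C ∣ + q              ≤⟨ +-monoˡ-≤ q ∣C∣≤q ⟩
      q + q                  ≡⟨ q+q≡q*2 ⟩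
      q * 2                  ≤⟨ *-monoʳ-≤ q 2≤r ⟩
      q * r X                ≤⟨ n≤1+n _ ⟩
      suc (q * r X)          ∎
      where open ≤-Reasoning
    ...   | no 2≰r = +-mono-≤ {∣ X ∣} {1} (s≤s⁻¹ (r<2⇒∣X∣<2 (proj₁ X⊂E) (≰⇒> 2≰r))) (begin
      q        ≡⟨ *-identityʳ q ⟨
      q * 1    ≤⟨ *-monoʳ-≤ q (s≤∣X∣⇒s≤r (s≤s z≤n) (proj₁ X⊂E) (x∈p⇒1≤∣p∣ x∈X)) ⟩
      q * r X  ∎)
      where open ≤-Reasoning

    sparse : Nonempty X → X ⊂ E M → ∣ X ∣ + q ≤ suc (q * r X)
    sparse = sparse′ _ ≤-refl

    ∣X∣≡∣X-e∣+1 : ∀ {e} → e ∈ X → ∣ X ∣ ≡ ∣ X - e ∣ + 1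
    ∣X∣≡∣X-e∣+1 {X} {e} e∈X =
      trans (q⊆p⇒∣p∣≡∣p─q∣+∣q∣ (x∈p⇒⁅x⁆⊆p e∈X)) (cong (∣ X - e ∣ +_) (∣⁅x⁆∣≡1 e))

    -- `sparse` speaks of proper subsets only. It is applied to `E M - e`, and restoring `e` is the
    -- reason for 2 in place of 1; a one-element ground set is treated apart.
    ∣E∣-bound : Nonempty (E M) → ∣ E M ∣ + q ≤ 2 + q * r (E M)
    ∣E∣-bound (e , e∈E) with nonempty? (E M - e)
    ... | yes E-e≠∅ = begin
      ∣ E M ∣ + q              ≡⟨ cong (_+ q) (trans (∣X∣≡∣X-e∣+1 e∈E) (+-comm _ 1)) ⟩
      suc (∣ E M - e ∣ + q)    ≤⟨ s≤s (sparse E-e≠∅ (x∈p⇒p-x⊂p e∈E)) ⟩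
      2 + q * r (E M - e)      ≤⟨ +-monoʳ-≤ 2 (*-monoʳ-≤ q (r-mono (p─q⊆p (E M) ⁅ e ⁆))) ⟩
      2 + q * r (E M)          ∎
      where open ≤-Reasoning
    ... | no E-e=∅ = begin
      ∣ E M ∣ + q       ≡⟨ cong (_+ q) (trans (∣X∣≡∣X-e∣+1 e∈E) (cong (_+ 1) (Empty⇒∣p∣≡0 E-e=∅))) ⟩
      suc q             ≡⟨ cong suc (*-identityʳ q) ⟨
      suc (q * 1)       ≤⟨ s≤s (*-monoʳ-≤ q (s≤∣X∣⇒s≤r (s≤s z≤n) (λ z → z) (x∈p⇒1≤∣p∣ e∈E))) ⟩
      suc (q * r (E M)) ≤⟨ n≤1+n _ ⟩
      2 + q * r (E M)   ∎
      where open ≤-Reasoning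

  Tight : Subset n → Set
  Tight X = X ⊆ E M × ∣ X ∣ + q ≡ suc (q * r X)

  -- Tightness makes such a set closed: adding an element without raising the rank would violate
  -- `sparse`. So these are hyperplanes in the usual sense, but only the tight ones.
  Hyperplane : Subset n → Set
  Hyperplane H = Tight H × suc (r H) ≡ r (E M)

  Line : Subset n → Set
  Line L = Tight L × r L ≡ 2

  opaque
    -- For the empty set the equation would read `q ≡ 1`.
    tight⇒nonempty : Tight X → Nonempty X
    tight⇒nonempty {X} (_ , eq) with nonempty? X
    ... | yes X≠∅ = X≠∅
    ... | no  X=∅ = contradiction (begin
      2                  ≤⟨ ≤-trans (n≤1+n 2) 3≤q ⟩
      q                  ≡⟨ cong (_+ q) (Empty⇒∣p∣≡0 X=∅) ⟨
      ∣ X ∣ + q          ≡⟨ eq ⟩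
      suc (q * r X)      ≤⟨ s≤s (*-monoʳ-≤ q (≤-trans (r≤∣X∣ X) (≤-reflexive (Empty⇒∣p∣≡0 X=∅)))) ⟩
      suc (q * 0)        ≡⟨ cong suc (*-zeroʳ q) ⟩
      1                  ∎) λ { (s≤s ()) }
      where open ≤-Reasoning

    ∣L∣≡1+q : Line L → ∣ L ∣ ≡ suc q
    ∣L∣≡1+q {L} ((_ , eq) , rL≡2) = +-cancelʳ-≡ q ∣ L ∣ (suc q)
      (trans eq (trans (cong (λ z → suc (q * z)) rL≡2) (arith q)))
      where
      arith : ∀ q → suc (q * 2) ≡ suc q + q
      arith = solve 1 (λ q → (con 1 :+ (q :* con 2)) := (con 1 :+ q) :+ q) refl

    -- Deleting a small cocircuit loses at most `q` elements, which is what one unit of rank is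
    -- worth in the tight equation. Since the remainder obeys `sparse`, exactly one unit is lost and
    -- the inequalities become equalities.
    tight-step : Tight X → X ⊂ E M → 2 ≤ r X → ∃[ Y ] Y ⊆ X × Tight Y × suc (r Y) ≡ r X
    tight-step {X} tX@(X⊆E , eq) X⊂E 2≤r
      with C , C* , ∣C∣≤q ← small-cocircuit (tight⇒nonempty tX) X⊂E
      = X ─ C , p─q⊆p X C , (Y⊆E , ≤-antisym sparse-Y dense-Y) , suc-r
      where
      open ≤-Reasoning

      Y⊆E : X ─ C ⊆ E M
      Y⊆E = X⊆E ∘ p─q⊆p X C

      ∣X∣≤ : ∣ X ∣ ≤ ∣ X ─ C ∣ + q
      ∣X∣≤ = ≤-trans (∣p∣≤∣p─q∣+∣q∣ X C) (+-monoʳ-≤ _ ∣C∣≤q)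

      -- `sparse` requires a nonempty set. Rank at least 2 makes `∣ X ∣` at least `q + 1`, too large
      -- for `C` to exhaust.
      Y≠∅ : Nonempty (X ─ C)
      Y≠∅ with nonempty? (X ─ C)
      ... | yes Y≠∅ = Y≠∅
      ... | no  Y=∅ = contradiction (begin-strict
        q + q              ≡⟨ q+q≡q*2 ⟩
        q * 2              ≤⟨ *-monoʳ-≤ q 2≤r ⟩
        q * r X            <⟨ n<1+n _ ⟩
        suc (q * r X)      ≡⟨ eq ⟨
        ∣ X ∣ + q          ≤⟨ +-monoˡ-≤ q ∣X∣≤ ⟩
        ∣ X ─ C ∣ + q + q  ≡⟨ cong (λ z → z + q + q) (Empty⇒∣p∣≡0 Y=∅) ⟩
        q + q              ∎) (<-irrefl refl)

      sparse-Y : ∣ X ─ C ∣ + q ≤ suc (q * r (X ─ C))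
      sparse-Y = sparse Y≠∅ (⊆-⊂-trans (p─q⊆p X C) X⊂E)

      suc-r : suc (r (X ─ C)) ≡ r X
      suc-r = ≤-antisym (cocircuit⇒r< C*) (s≤s⁻¹ (*-cancelˡ-< q (r X) (2 + r (X ─ C)) (begin-strict
        q * r X                  <⟨ n<1+n _ ⟩
        suc (q * r X)            ≡⟨ eq ⟨
        ∣ X ∣ + q                ≤⟨ +-monoˡ-≤ q ∣X∣≤ ⟩
        ∣ X ─ C ∣ + q + q        ≤⟨ +-monoˡ-≤ q sparse-Y ⟩
        -- The 1 is enlarged to `q` so that both ends are multiples of `q`, which cancels.
        suc (q * r (X ─ C)) + q  ≤⟨ +-monoˡ-≤ q (+-monoˡ-≤ (q * r (X ─ C)) 1≤q) ⟩
        q + q * r (X ─ C) + q    ≡⟨ arith q (r (X ─ C)) ⟩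
        q * (2 + r (X ─ C))      ∎)))
        where
        arith : ∀ q a → q + q * a + q ≡ q * (2 + a)
        arith = solve 2 (λ q a → q :+ q :* a :+ q := q :* (con 2 :+ a)) refl

      dense-Y : suc (q * r (X ─ C)) ≤ ∣ X ─ C ∣ + q
      dense-Y = +-cancelʳ-≤ q _ _ (begin
        suc (q * r (X ─ C)) + q    ≡⟨ 1+qa+q≡1+q[1+a] _ ⟩
        suc (q * suc (r (X ─ C)))  ≡⟨ cong (λ z → suc (q * z)) suc-r ⟩
        suc (q * r X)              ≡⟨ eq ⟨
        ∣ X ∣ + q                  ≤⟨ +-monoˡ-≤ q ∣X∣≤ ⟩
        ∣ X ─ C ∣ + q + q          ∎)

    tight-step-size : Tight X → Tight Y → suc (r Y) ≡ r X → ∣ X ∣ ≡ ∣ Y ∣ + q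
    tight-step-size {X} {Y} (_ , eqX) (_ , eqY) rX = +-cancelʳ-≡ q _ _ (begin
      ∣ X ∣ + q            ≡⟨ eqX ⟩
      suc (q * r X)        ≡⟨ cong (λ z → suc (q * z)) rX ⟨
      suc (q * suc (r Y))  ≡⟨ sym (1+qa+q≡1+q[1+a] _) ⟩
      suc (q * r Y) + q    ≡⟨ cong (_+ q) eqY ⟨
      ∣ Y ∣ + q + q        ∎)
      where open ≡-Reasoning

    -- `Y` is closed, so a set `Z` reaching outside it raises the rank of the union; submodularity
    -- turns this into a drop on the intersection.
    r[Z∩Y]<rZ : Tight Y → r Y < r (E M) → Z ⊆ E M → Z ⊈ Y → r (Z ∩ Y) < r Z
    r[Z∩Y]<rZ {Y} {Z} tY@(Y⊆E , eq) rY<rE Z⊆E Z⊈Y = +-cancelˡ-≤ (r Y) _ _ (begin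
      r Y + suc (r (Z ∩ Y))    ≡⟨ +-suc (r Y) _ ⟩
      suc (r Y) + r (Z ∩ Y)    ≤⟨ +-monoˡ-≤ _ rY<r∪ ⟩
      r (Z ∪ Y) + r (Z ∩ Y)    ≤⟨ r-submodular Z Y ⟩
      r Z + r Y                ≡⟨ +-comm (r Z) (r Y) ⟩
      r Y + r Z                ∎)
      where
      open ≤-Reasoning

      -- Otherwise `Z ∪ Y` would be a proper subset with the rank of the tight set `Y`, and `sparse`
      -- would leave it no element beyond `Y`.
      rY<r∪ : r Y < r (Z ∪ Y)
      rY<r∪ = ≰⇒> λ r∪≤rY → Z⊈Y (p⊆q∧∣q∣≤∣p∣⇒q⊆p (q⊆p∪q Z Y) (+-cancelʳ-≤ q _ _ (begin
        ∣ Z ∪ Y ∣ + q        ≤⟨ sparse (proj₁ (tight⇒nonempty tY) , q⊆p∪q Z Y (proj₂ (tight⇒nonempty tY)))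
                                  (p⊆q∧q⊈p⇒p⊂q (∪-lub Z⊆E Y⊆E) (r<⇒⊈ (≤-<-trans r∪≤rY rY<rE))) ⟩
        suc (q * r (Z ∪ Y))  ≤⟨ s≤s (*-monoʳ-≤ q r∪≤rY) ⟩
        suc (q * r Y)        ≡⟨ eq ⟨
        ∣ Y ∣ + q            ∎)) ∘ p⊆p∪q Y)

  -- The extremal case: tight hyperplanes and tight lines

  module Extremal (∣E∣ : ∣ E M ∣ + q ≡ 2 + q * r (E M)) (2≤rE : 2 ≤ r (E M)) where

    opaque
      -- `E M` has one element more than the tight size of its rank, so deleting one leaves that
      -- size; a smaller rank would contradict `sparse`.
      delete-tight : ∀ {e} → e ∈ E M → Tight (E M - e) × r (E M - e) ≡ r (E M)
      delete-tight {e} e∈E =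
        (p─q⊆p _ _ , trans size (cong (λ z → suc (q * z)) (sym r≡))) , r≡
        where
        open ≤-Reasoning

        size : ∣ E M - e ∣ + q ≡ suc (q * r (E M))
        size = suc-injective (trans (cong (_+ q) (trans (+-comm 1 _) (sym (∣X∣≡∣X-e∣+1 e∈E)))) ∣E∣)

        E-e≠∅ : Nonempty (E M - e)
        E-e≠∅ with nonempty? (E M - e)
        ... | yes ne = ne
        ... | no  em = contradiction (begin-strict
          q                  ≡⟨ *-identityʳ q ⟨
          q * 1              ≤⟨ *-monoʳ-≤ q (≤-trans (n≤1+n 1) 2≤rE) ⟩
          q * r (E M)        <⟨ n<1+n _ ⟩
          suc (q * r (E M))  ≡⟨ size ⟨
          ∣ E M - e ∣ + q    ≡⟨ cong (_+ q) (Empty⇒∣p∣≡0 em) ⟩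
          q                  ∎) (<-irrefl refl)

        r≡ : r (E M - e) ≡ r (E M)
        r≡ = ≤-antisym (r-mono (p─q⊆p _ _)) (s≤s⁻¹ (*-cancelˡ-< q _ _ (begin-strict
          q * r (E M)              <⟨ n<1+n _ ⟩
          suc (q * r (E M))        ≡⟨ size ⟨
          ∣ E M - e ∣ + q          ≤⟨ sparse E-e≠∅ (x∈p⇒p-x⊂p e∈E) ⟩
          suc (q * r (E M - e))    ≤⟨ +-monoˡ-≤ (q * r (E M - e)) 1≤q ⟩
          q + q * r (E M - e)      ≡⟨ *-suc q _ ⟨
          q * suc (r (E M - e))    ∎)))

      -- `tight-step` goes down from `E M - e`, which still has full rank.
      hyperplane-avoiding : ∀ {e} → e ∈ E M → ∃[ H ] Hyperplane H × e ∉ H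
      hyperplane-avoiding {e} e∈E
        with tE-e , rE-e ← delete-tight e∈E
        with H , H⊆ , tH , rH ← tight-step tE-e (x∈p⇒p-x⊂p e∈E) (subst (2 ≤_) (sym rE-e) 2≤rE)
        = H , (tH , trans rH rE-e) , λ e∈H → x∈p─q⇒x∉q (E M) ⁅ e ⁆ (H⊆ e∈H) (x∈⁅x⁆ e)

      -- The gap exceeds the `q` of `tight-step-size` by the one surplus element of `E M`.
      ∣E∣≡∣H∣+1+q : Hyperplane H → ∣ E M ∣ ≡ ∣ H ∣ + suc q
      ∣E∣≡∣H∣+1+q {H} ((_ , eq) , rH) = +-cancelʳ-≡ q _ _ (begin
        ∣ E M ∣ + q              ≡⟨ ∣E∣ ⟩
        2 + q * r (E M)          ≡⟨ cong (λ z → 2 + q * z) rH ⟨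
        2 + q * suc (r H)        ≡⟨ arith₁ q (r H) ⟩
        suc (q * r H) + suc q    ≡⟨ cong (_+ suc q) eq ⟨
        ∣ H ∣ + q + suc q        ≡⟨ arith₂ ∣ H ∣ q ⟩
        ∣ H ∣ + suc q + q        ∎)
        where
        open ≡-Reasoning
        arith₁ : ∀ q a → 2 + q * suc a ≡ suc (q * a) + suc q
        arith₁ = solve 2 (λ q a → con 2 :+ q :* (con 1 :+ a) := (con 1 :+ (q :* a)) :+ (con 1 :+ q)) refl
        arith₂ : ∀ h q → h + q + suc q ≡ h + suc q + q
        arith₂ = solve 2 (λ h q → h :+ q :+ (con 1 :+ q) := h :+ (con 1 :+ q) :+ q) refl

      r[Z∩H]<rZ : Hyperplane H → Z ⊆ E M → Z ⊈ H → r (Z ∩ H) < r Z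
      r[Z∩H]<rZ (tH , rH) = r[Z∩Y]<rZ tH (≤-reflexive rH)

      ∣L∩H∣≤1 : Line L → Hyperplane H → L ⊈ H → ∣ L ∩ H ∣ ≤ 1
      ∣L∩H∣≤1 {L} {H} ((L⊆E , _) , rL) hH L⊈H = s≤s⁻¹ (r<2⇒∣X∣<2 (L⊆E ∘ p∩q⊆p L H)
        (subst (r (L ∩ H) <_) rL (r[Z∩H]<rZ hH L⊆E L⊈H)))

    module _ (3≤rE : 3 ≤ r (E M)) where

      opaque
        -- `H ∩ H′` has smaller rank than `H′`, hence by `sparse` at least `q` elements fewer. So
        -- the union has at least `∣ H ∣ + q` elements, all but at most one of `E M`.
        ∣E─H∪H′∣≤1 : Hyperplane H → Hyperplane H′ → H′ ⊈ H →
                     Z ⊆ E M → (∀ {x} → x ∈ Z → x ∉ H) → (∀ {x} → x ∈ Z → x ∉ H′) → ∣ Z ∣ ≤ 1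
        ∣E─H∪H′∣≤1 {H} {H′} {Z} hH@((H⊆E , _) , _) hH′@((H′⊆E , eq′) , rH′) H′⊈H Z⊆E Z∩H Z∩H′ =
          ≤-by-cancellation (+-mono-≤ disjoint ∣W∣-bound)
            (arith (∣ Z ∣) (∣ H ∣) (∣ H′ ∣) (∣ H′ ∪ H ∣) (∣ H′ ∩ H ∣) q (q * r H′)
              eq′ (∣p∪q∣+∣p∩q∣≡∣p∣+∣q∣ H′ H))
          where
          open ≤-Reasoning

          disjoint : ∣ H′ ∪ H ∣ + ∣ Z ∣ ≤ ∣ H ∣ + suc q
          disjoint = subst (_ ≤_) (∣E∣≡∣H∣+1+q hH) (disjoint⇒∣p∣+∣q∣≤∣r∣ (∪-lub H′⊆E H⊆E) Z⊆E
            λ x∈Z → [ Z∩H′ x∈Z , Z∩H x∈Z ]′ ∘ x∈p∪q⁻ H′ H)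

          2≤rH′ : 2 ≤ r H′
          2≤rH′ = s≤s⁻¹ (subst (3 ≤_) (sym rH′) 3≤rE)

          ∣W∣-bound : ∣ H′ ∩ H ∣ + (q + q) ≤ suc (q * r H′)
          ∣W∣-bound with nonempty? (H′ ∩ H)
          ... | yes W≠∅ = begin
            ∣ H′ ∩ H ∣ + (q + q)        ≡⟨ +-assoc _ q q ⟨
            ∣ H′ ∩ H ∣ + q + q          ≤⟨ +-monoˡ-≤ q (sparse W≠∅ (p⊆q∧q⊈p⇒p⊂q (H⊆E ∘ p∩q⊆q H′ H)
                                             (r<⇒⊈ (≤-<-trans (r-mono (p∩q⊆p H′ H)) (≤-reflexive rH′))))) ⟩
            suc (q * r (H′ ∩ H)) + q    ≡⟨ 1+qa+q≡1+q[1+a] _ ⟩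
            suc (q * suc (r (H′ ∩ H)))  ≤⟨ s≤s (*-monoʳ-≤ q (r[Z∩H]<rZ hH H′⊆E H′⊈H)) ⟩
            suc (q * r H′)              ∎
          -- `sparse` says nothing about an empty intersection; there `2 ≤ r H′`, a consequence of
          -- `3 ≤ r (E M)`, gives the count.
          ... | no W=∅ = begin
            ∣ H′ ∩ H ∣ + (q + q)  ≡⟨ cong (_+ (q + q)) (Empty⇒∣p∣≡0 W=∅) ⟩
            q + q                 ≡⟨ q+q≡q*2 ⟩
            q * 2                 ≤⟨ *-monoʳ-≤ q 2≤rH′ ⟩
            q * r H′              ≤⟨ n≤1+n _ ⟩
            suc (q * r H′)        ∎

          arith : ∀ z h h′ u w q s → h′ + q ≡ suc s → u + w ≡ h′ + h →
                  z + (h + suc q + suc s) ≡ 1 + (u + z + (w + (q + q)))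
          arith z h h′ u w q s eq₁ eq₂ = begin-equality
            z + (h + suc q + suc s)       ≡⟨ cong (λ t → z + (h + suc q + t)) eq₁ ⟨
            z + (h + suc q + (h′ + q))    ≡⟨ lem₁ z h h′ q ⟩
            1 + ((h′ + h) + (z + (q + q)))  ≡⟨ cong (λ t → 1 + (t + (z + (q + q)))) eq₂ ⟨
            1 + ((u + w) + (z + (q + q)))   ≡⟨ lem₂ z u w q ⟩
            1 + (u + z + (w + (q + q)))   ∎
            where
            lem₁ : ∀ z h h′ q → z + (h + suc q + (h′ + q)) ≡ 1 + ((h′ + h) + (z + (q + q)))
            lem₁ = solve 4 (λ z h h′ q → z :+ (h :+ (con 1 :+ q) :+ (h′ :+ q)) := con 1 :+ ((h′ :+ h) :+ (z :+ (q :+ q)))) refl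
            lem₂ : ∀ z u w q → 1 + ((u + w) + (z + (q + q))) ≡ 1 + (u + z + (w + (q + q)))
            lem₂ = solve 4 (λ z u w q → con 1 :+ ((u :+ w) :+ (z :+ (q :+ q))) := con 1 :+ (u :+ z :+ (w :+ (q :+ q)))) refl

        -- A hyperplane `H` avoiding a point `e` of `L` is the complement as soon as it misses `L`,
        -- since the sizes agree. If it met `L` in `g`, a second hyperplane avoiding `g` would
        -- differ from `H`.
        line-complement : Line L → Hyperplane (E M ─ L)
        line-complement {L} lL@(tL@(L⊆E , _) , rL)
          with e , e∈L ← tight⇒nonempty tL
          with H , hH@((H⊆E , _) , _) , e∉H ← hyperplane-avoiding (L⊆E e∈L)
          with nonempty? (L ∩ H)
        ... | no L∩H=∅ = subst Hyperplane (⊆-antisym H⊆E─L (p⊆q∧∣q∣≤∣p∣⇒q⊆p H⊆E─L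
                (≤-reflexive (+-cancelʳ-≡ (suc q) _ _ (begin
                  ∣ E M ─ L ∣ + suc q  ≡⟨ cong (∣ E M ─ L ∣ +_) (∣L∣≡1+q lL) ⟨
                  ∣ E M ─ L ∣ + ∣ L ∣  ≡⟨ q⊆p⇒∣p∣≡∣p─q∣+∣q∣ L⊆E ⟨
                  ∣ E M ∣              ≡⟨ ∣E∣≡∣H∣+1+q hH ⟩
                  ∣ H ∣ + suc q        ∎))))) hH
          where
          open ≡-Reasoning

          H⊆E─L : H ⊆ E M ─ L
          H⊆E─L {x} x∈H = x∈p∧x∉q⇒x∈p─q (H⊆E x∈H) λ x∈L → L∩H=∅ (x , x∈p∩q⁺ (x∈L , x∈H))
        ... | yes (g , g∈L∩H)
          with g∈L , g∈H ← x∈p∩q⁻ L H g∈L∩H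
          with H′ , hH′ , g∉H′ ← hyperplane-avoiding (L⊆E g∈L)
          = contradiction (begin
          -- `L` has at least four points because `3 ≤ q`, but `H`, `H′` and the outside of both
          -- hold at most one each.
          4                              ≤⟨ s≤s 3≤q ⟩
          suc q                          ≡⟨ ∣L∣≡1+q lL ⟨
          ∣ L ∣                          ≡⟨ ∣p∣≡∣p∩q∣+∣p─q∣ L H ⟩
          ∣ L ∩ H ∣ + ∣ L ─ H ∣          ≡⟨ cong (∣ L ∩ H ∣ +_) (∣p∣≡∣p∩q∣+∣p─q∣ (L ─ H) H′) ⟩
          ∣ L ∩ H ∣ + (∣ (L ─ H) ∩ H′ ∣ + ∣ L ─ H ─ H′ ∣)
            ≤⟨ +-mono-≤ (∣L∩H∣≤1 lL hH (λ L⊆H → e∉H (L⊆H e∈L)))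
                 (+-mono-≤ (≤-trans (p⊆q⇒∣p∣≤∣q∣ ⊆L∩H′)
                              (∣L∩H∣≤1 lL hH′ (λ L⊆H′ → g∉H′ (L⊆H′ g∈L))))
                    (∣E─H∪H′∣≤1 hH′ hH (λ H⊆H′ → g∉H′ (H⊆H′ g∈H))
                      (λ x∈ → L⊆E (p─q⊆p L H (p─q⊆p (L ─ H) H′ x∈)))
                      (x∈p─q⇒x∉q (L ─ H) H′)
                      (λ x∈ → x∈p─q⇒x∉q L H (p─q⊆p (L ─ H) H′ x∈)))) ⟩
          3                              ∎) λ { (s≤s (s≤s (s≤s ()))) }
          where
          open ≤-Reasoning

          ⊆L∩H′ : (L ─ H) ∩ H′ ⊆ L ∩ H′
          ⊆L∩H′ x∈ with x∈L─H , x∈H′ ← x∈p∩q⁻ (L ─ H) H′ x∈ = x∈p∩q⁺ (p─q⊆p L H x∈L─H , x∈H′)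

        -- If `L ⊈ Y`, closedness of `Y` leaves at most one point in `L ∩ Y`. As `∣ X ∣ ≡ ∣ Y ∣ + q`
        -- and `∣ L ∣ ≡ suc q`, counting forces `X ≡ L ∪ Y` and exactly one common point. It then
        -- remains to show `Y ⊆ L`.
        line-persists : Line L → Tight X → L ⊆ X → Tight Y → Y ⊆ X → suc (r Y) ≡ r X →
                        L ⊆ Y ⊎ X ⊆ L
        line-persists {L} {X} {Y} lL@(tL@(L⊆E , _) , rL) tX@(X⊆E , _) L⊆X tY@(Y⊆E , eqY) Y⊆X rX
          with L ⊆? Y
        ... | yes L⊆Y = inj₁ L⊆Y
        ... | no  L⊈Y = inj₂ λ x∈X →
          ∪-lub (λ x∈L → x∈L) Y⊆L (p⊆q∧∣q∣≤∣p∣⇒q⊆p (∪-lub L⊆X Y⊆X) ∣X∣≤∣L∪Y∣ x∈X)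
          where
          open ≤-Reasoning

          ∣L∩Y∣≤1 : ∣ L ∩ Y ∣ ≤ 1
          ∣L∩Y∣≤1 = s≤s⁻¹ (r<2⇒∣X∣<2 (L⊆E ∘ p∩q⊆p L Y) (subst (r (L ∩ Y) <_) rL
            (r[Z∩Y]<rZ tY (≤-trans (≤-reflexive rX) (r-mono X⊆E)) L⊆E L⊈Y)))

          ∣X∣+1 : ∣ X ∣ + 1 ≡ ∣ L ∪ Y ∣ + ∣ L ∩ Y ∣
          ∣X∣+1 = begin-equality
            ∣ X ∣ + 1                ≡⟨ cong (_+ 1) (tight-step-size tX tY rX) ⟩
            ∣ Y ∣ + q + 1            ≡⟨ trans (+-assoc (∣ Y ∣) q 1) (cong (∣ Y ∣ +_) (+-comm q 1)) ⟩
            ∣ Y ∣ + suc q            ≡⟨ +-comm (∣ Y ∣) (suc q) ⟩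
            suc q + ∣ Y ∣            ≡⟨ cong (_+ ∣ Y ∣) (∣L∣≡1+q lL) ⟨
            ∣ L ∣ + ∣ Y ∣            ≡⟨ ∣p∪q∣+∣p∩q∣≡∣p∣+∣q∣ L Y ⟨
            ∣ L ∪ Y ∣ + ∣ L ∩ Y ∣    ∎

          ∣X∣≤∣L∪Y∣ : ∣ X ∣ ≤ ∣ L ∪ Y ∣
          ∣X∣≤∣L∪Y∣ = ≤-by-cancellation ∣L∩Y∣≤1 ∣X∣+1

          1≤∣L∩Y∣ : 1 ≤ ∣ L ∩ Y ∣
          1≤∣L∩Y∣ = ≤-by-cancellation (p⊆q⇒∣p∣≤∣q∣ (∪-lub L⊆X Y⊆X))
            (trans (+-comm 1 _) (trans ∣X∣+1 (+-comm (∣ L ∪ Y ∣) _)))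

          Y⊈E─L : Y ⊈ E M ─ L
          Y⊈E─L Y⊆E─L = contradiction (subst (1 ≤_) (Empty⇒∣p∣≡0 λ (x , x∈) →
            x∈p─q⇒x∉q (E M) L (Y⊆E─L (p∩q⊆q L Y x∈)) (p∩q⊆p L Y x∈)) 1≤∣L∩Y∣) λ ()

          -- This is `Y ─ L`, written as a trace on the hyperplane `E M ─ L` so that `r[Z∩H]<rZ`
          -- applies to it.
          Y′ : Subset n
          Y′ = Y ∩ (E M ─ L)

          ∣Y∣≤∣Y′∣+1 : ∣ Y ∣ ≤ ∣ Y′ ∣ + 1
          ∣Y∣≤∣Y′∣+1 = begin
            ∣ Y ∣                          ≡⟨ ∣p∣≡∣p∩q∣+∣p─q∣ Y (E M ─ L) ⟩
            ∣ Y′ ∣ + ∣ Y ─ (E M ─ L) ∣     ≤⟨ +-monoʳ-≤ (∣ Y′ ∣) (≤-trans (p⊆q⇒∣p∣≤∣q∣ ⊆L∩Y) ∣L∩Y∣≤1) ⟩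
            ∣ Y′ ∣ + 1                     ∎
            where
            ⊆L∩Y : Y ─ (E M ─ L) ⊆ L ∩ Y
            ⊆L∩Y {x} x∈ = x∈p∩q⁺ (decidable-stable (x ∈? L) (λ x∉L →
              x∈p─q⇒x∉q Y (E M ─ L) x∈ (x∈p∧x∉q⇒x∈p─q (Y⊆E x∈Y) x∉L)) , x∈Y)
              where
              x∈Y : x ∈ Y
              x∈Y = p─q⊆p Y (E M ─ L) x∈

          -- `Y′` is at most one element short of `Y` but has smaller rank, which by `sparse` costs
          -- `q` elements; `q ≥ 2` excludes this unless `Y′` is empty.
          Y′=∅ : Empty Y′
          Y′=∅ Y′≠∅ = contradiction (+-cancelˡ-≤ (∣ Y′ ∣) q 1 (+-cancelʳ-≤ q _ _ (begin
            ∣ Y′ ∣ + q + q        ≤⟨ +-monoˡ-≤ q (sparse Y′≠∅ (p⊆q∧q⊈p⇒p⊂q (Y⊆E ∘ p∩q⊆p Y (E M ─ L))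
                                       λ E⊆Y′ → Y⊈E─L λ x∈Y → p∩q⊆q Y (E M ─ L) (E⊆Y′ (Y⊆E x∈Y)))) ⟩
            suc (q * r Y′) + q    ≡⟨ 1+qa+q≡1+q[1+a] _ ⟩
            suc (q * suc (r Y′))  ≤⟨ s≤s (*-monoʳ-≤ q (r[Z∩H]<rZ (line-complement lL) Y⊆E Y⊈E─L)) ⟩
            suc (q * r Y)         ≡⟨ eqY ⟨
            ∣ Y ∣ + q             ≤⟨ +-monoˡ-≤ q ∣Y∣≤∣Y′∣+1 ⟩
            ∣ Y′ ∣ + 1 + q        ∎))) (<⇒≱ (≤-trans (n≤1+n 2) 3≤q))

          Y⊆L : Y ⊆ L
          Y⊆L {x} x∈Y = decidable-stable (x ∈? L) λ x∉L →
            Y′=∅ (x , x∈p∩q⁺ (x∈Y , x∈p∧x∉q⇒x∈p─q (Y⊆E x∈Y) x∉L))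

        -- Both lines are followed down a chain of tight sets, with `d` bounding the rank. By
        -- `line-persists` a line leaves the chain only at a set `X` that it contains, and there it
        -- contains the other line.
        lines-nested : ∀ d {X} → r X ≤ d → Tight X → X ⊂ E M → Line L → L ⊆ X → Line L′ → L′ ⊆ X →
                       L ⊆ L′ ⊎ L′ ⊆ L
        lines-nested zero rX≤0 _ _ (_ , rL) L⊆X _ _ =
          contradiction (subst (_≤ 0) rL (≤-trans (r-mono L⊆X) rX≤0)) λ ()
        lines-nested (suc d) rX≤d tX X⊂E lL@(_ , rL) L⊆X lL′ L′⊆X
          with Y , Y⊆X , tY , rX ← tight-step tX X⊂E (subst (_≤ _) rL (r-mono L⊆X))
          with line-persists lL tX L⊆X tY Y⊆X rX | line-persists lL′ tX L′⊆X tY Y⊆X rX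
        ... | inj₂ X⊆L | _         = inj₂ λ x∈L′ → X⊆L (L′⊆X x∈L′)
        ... | inj₁ _   | inj₂ X⊆L′ = inj₁ λ x∈L → X⊆L′ (L⊆X x∈L)
        ... | inj₁ L⊆Y | inj₁ L′⊆Y = lines-nested d (s≤s⁻¹ (subst (_≤ suc d) (sym rX) rX≤d)) tY
          (⊆-⊂-trans Y⊆X X⊂E) lL L⊆Y lL′ L′⊆Y

        contains-line : ∀ d {X} → r X ≤ 2 + d → Tight X → X ⊂ E M → 2 ≤ r X → ∃[ L ] Line L × L ⊆ X
        contains-line zero    rX≤ tX _ 2≤r = _ , (tX , ≤-antisym rX≤ 2≤r) , λ z → z
        contains-line (suc d) {X} rX≤ tX X⊂E 2≤r with r X ≤? 2
        ... | yes rX≤2 = X , (tX , ≤-antisym rX≤2 2≤r) , λ z → z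
        ... | no  rX≰2
          with Y , Y⊆X , tY , rX ← tight-step tX X⊂E 2≤r
          with L , lL , L⊆Y ← contains-line d (s≤s⁻¹ (subst (_≤ 3 + d) (sym rX) rX≤)) tY
                 (⊆-⊂-trans Y⊆X X⊂E) (s≤s⁻¹ (subst (3 ≤_) (sym rX) (≰⇒> rX≰2)))
          = L , lL , λ x∈L → Y⊆X (L⊆Y x∈L)

        -- The hyperplanes `H` and `E M ─ L` are told apart by `e`, so at most one point escapes
        -- both. If `L ⊈ H`, then `L` would consist of that point and at most one point of `H`.
        line⊆hyperplane : ∀ {e} → e ∈ E M → e ∉ H → Hyperplane H → Line L → e ∉ L → L ⊆ H
        line⊆hyperplane {H} {L} {e} e∈E e∉H hH lL@((L⊆E , _) , _) e∉L =
          decidable-stable (L ⊆? H) λ L⊈H → contradiction (begin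
            4                        ≤⟨ s≤s 3≤q ⟩
            suc q                    ≡⟨ ∣L∣≡1+q lL ⟨
            ∣ L ∣                    ≡⟨ ∣p∣≡∣p∩q∣+∣p─q∣ L H ⟩
            ∣ L ∩ H ∣ + ∣ L ─ H ∣    ≤⟨ +-mono-≤ (∣L∩H∣≤1 lL hH L⊈H)
                                         (∣E─H∪H′∣≤1 hH (line-complement lL)
                                           (λ E─L⊆H → e∉H (E─L⊆H (x∈p∧x∉q⇒x∈p─q e∈E e∉L)))
                                           (L⊆E ∘ p─q⊆p L H) (x∈p─q⇒x∉q L H)
                                           (λ x∈ x∈E─L → x∈p─q⇒x∉q (E M) L x∈E─L (p─q⊆p L H x∈))) ⟩
            2                        ∎) λ { (s≤s (s≤s ())) }
          where open ≤-Reasoning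

        two-lines : ∃[ L ] ∃[ L′ ] Line L × Line L′ × (∀ {x} → x ∈ L′ → x ∉ L) × E M ⊆ L ∪ L′
        two-lines
          -- Any point serves: its deletion yields a proper tight set of full rank to descend from.
          with e , e∈E ← 1≤r⇒nonempty (≤-trans (n≤1+n 1) 2≤rE)
          with tE-e , rE-e ← delete-tight e∈E
          with L , lL@(tL@(L⊆E , _) , _) , _ ← contains-line (r (E M - e)) (m≤n+m _ 2) tE-e
                 (x∈p⇒p-x⊂p e∈E) (subst (2 ≤_) (sym rE-e) 2≤rE)
          with tK , rK ← line-complement lL
          with L′ , lL′@(tL′@(L′⊆E , _) , _) , L′⊆K ← contains-line (r (E M ─ L)) (m≤n+m _ 2) tK
                 (let x , x∈L = tight⇒nonempty tL in
                  p─q⊆p (E M) L , x , L⊆E x∈L , λ x∈K → x∈p─q⇒x∉q (E M) L x∈K x∈L)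
                 -- Rank at least 3 leaves the complement of `L` rank at least 2, enough to hold a
                 -- line.
                 (s≤s⁻¹ (subst (3 ≤_) (sym rK) 3≤rE))
          = L , L′ , lL , lL′ , disjoint , λ {x} x∈E → decidable-stable (x ∈? L ∪ L′) λ x∉ →
              let H , hH@(tH , _) , x∉H = hyperplane-avoiding x∈E
                  L⊆H  = line⊆hyperplane x∈E x∉H hH lL  (x∉ ∘ p⊆p∪q L′)
                  L′⊆H = line⊆hyperplane x∈E x∉H hH lL′ (x∉ ∘ q⊆p∪q L L′)
                  y , y∈L = tight⇒nonempty tL
                  z , z∈L′ = tight⇒nonempty tL′
              in [ (λ L⊆L′ → disjoint (L⊆L′ y∈L) y∈L) , (λ L′⊆L → disjoint z∈L′ (L′⊆L z∈L′)) ]′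
                   (lines-nested (r H) ≤-refl tH (proj₁ tH , x , x∈E , x∉H) lL L⊆H lL′ L′⊆H)
          where
          disjoint : ∀ {x} → x ∈ L′ → x ∉ L
          disjoint x∈L′ = x∈p─q⇒x∉q (E M) L (L′⊆K x∈L′)

-- Isomorphisms and uniform matroids

comprehension : ∀ {P : Pred (Fin n) 0ℓ} → Decidable P → ∃[ Y ] (∀ {x} → x ∈ Y ⇔ P x)
comprehension {P = P} P? = tabulate (does ∘ P?) , λ {x} → mk⇔ (to x) (from x)
  where
  to : ∀ x → x ∈ tabulate (does ∘ P?) → P x
  to x x∈ with P? x | trans (sym (lookup∘tabulate (does ∘ P?) x)) ([]=⇒lookup x∈)
  ... | yes Px | _ = Px

  from : ∀ x → P x → x ∈ tabulate (does ∘ P?)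
  from x Px = lookup⇒[]= x _ (trans (lookup∘tabulate (does ∘ P?) x) (dec-true (P? x) Px))

-- The map takes a membership proof, since an isomorphism is defined on the ground set alone. The
-- image of the first element is removed from `q` before recursing; injectivity keeps the other
-- images.
injection⇒∣p∣≤∣q∣ : ∀ (p : Subset m) (q : Subset n) (f : ∀ {x} → x ∈ p → Fin n) →
                    (∀ {x} (x∈p : x ∈ p) → f x∈p ∈ q) →
                    (∀ {x y} (x∈p : x ∈ p) (y∈p : y ∈ p) → f x∈p ≡ f y∈p → x ≡ y) →
                    ∣ p ∣ ≤ ∣ q ∣
injection⇒∣p∣≤∣q∣ []          q f f∈q inj = z≤n
injection⇒∣p∣≤∣q∣ (false ∷ p) q f f∈q inj =
  injection⇒∣p∣≤∣q∣ p q (f ∘ there) (f∈q ∘ there) λ x∈p y∈p eq →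
    sucᶠ-injective (inj (there x∈p) (there y∈p) eq)
injection⇒∣p∣≤∣q∣ (true  ∷ p) q f f∈q inj = ≤-trans
  (s≤s (injection⇒∣p∣≤∣q∣ p (q - f here) (f ∘ there)
    (λ x∈p → x∈p∧x≢y⇒x∈p-y (f∈q (there x∈p)) (λ eq → contradiction (inj (there x∈p) here eq) λ ()))
    λ x∈p y∈p eq → sucᶠ-injective (inj (there x∈p) (there y∈p) eq)))
  (x∈p⇒∣p-x∣<∣p∣ (f∈q here))

∈-pair-≡ : {e f : ∃ (_∈ p)} → proj₁ e ≡ proj₁ f → e ≡ f
∈-pair-≡ {e = x , x∈} {f = x , x∈′} refl = cong (x ,_) ([]=-irrelevant x∈ x∈′)

Corresponds : ∃ (_∈ p) ↔ ∃ (_∈ t) → Subset _ → Subset _ → Set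
Corresponds {p = p} φ X Y = ∀ (e : ∃ (_∈ p)) → proj₁ e ∈ X ⇔ proj₁ (Inverse.to φ e) ∈ Y

corresponds-sym : (φ : ∃ (_∈ p) ↔ ∃ (_∈ t)) → ∀ {X Y} → Corresponds φ X Y → Corresponds (↔-sym φ) Y X
corresponds-sym φ {X} {Y} X~Y e = mk⇔
  (λ e∈Y → Equivalence.from (X~Y (from e)) (subst (_∈ Y) (cong proj₁ (sym (strictlyInverseˡ e))) e∈Y))
  (λ e∈X → subst (_∈ Y) (cong proj₁ (strictlyInverseˡ e)) (Equivalence.to (X~Y (from e)) e∈X))
  where open Inverse φ

corresponds⇒∣X∣≤∣Y∣ : (φ : ∃ (_∈ p) ↔ ∃ (_∈ t)) → ∀ {X Y} → X ⊆ p → Corresponds φ X Y → ∣ X ∣ ≤ ∣ Y ∣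
corresponds⇒∣X∣≤∣Y∣ φ {X} {Y} X⊆p X~Y = injection⇒∣p∣≤∣q∣ X Y
  (λ {x} x∈X → proj₁ (to (x , X⊆p x∈X)))
  (λ {x} x∈X → Equivalence.to (X~Y (x , X⊆p x∈X)) x∈X)
  (λ {x} {y} x∈X y∈X eq → cong proj₁ (trans (sym (strictlyInverseʳ (x , X⊆p x∈X)))
     (trans (cong from (∈-pair-≡ eq)) (strictlyInverseʳ (y , X⊆p y∈X)))))
  where open Inverse φ

corresponds⇒∣X∣≡∣Y∣ : (φ : ∃ (_∈ p) ↔ ∃ (_∈ t)) → ∀ {X Y} → X ⊆ p → Y ⊆ t → Corresponds φ X Y → ∣ X ∣ ≡ ∣ Y ∣
corresponds⇒∣X∣≡∣Y∣ φ X⊆p Y⊆t X~Y = ≤-antisym (corresponds⇒∣X∣≤∣Y∣ φ X⊆p X~Y)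
  (corresponds⇒∣X∣≤∣Y∣ (↔-sym φ) Y⊆t (corresponds-sym φ X~Y))

-- Membership in `Y` is an existential over `y ∈ t`, as `from` expects that proof. It is decidable
-- because such proofs are unique.
image : (φ : ∃ (_∈ p) ↔ ∃ (_∈ t)) → ∀ X → ∃[ Y ] Y ⊆ t × Corresponds φ X Y
image {p = p} {t = t} φ X = Y , (λ y∈Y → proj₁ (Equivalence.to ∈Y y∈Y)) , λ e → mk⇔
      (λ e∈X → Equivalence.from ∈Y (proj₂ (to e) , subst (_∈ X) (sym (cong proj₁ (strictlyInverseʳ e))) e∈X))
      (λ e∈Y → let (y∈t , x∈X) = Equivalence.to ∈Y e∈Y in
         subst (_∈ X) (trans (cong (λ h → proj₁ (from (proj₁ (to e) , h))) ([]=-irrelevant y∈t _))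
                             (cong proj₁ (strictlyInverseʳ e))) x∈X)
  where
  open Inverse φ

  dec : Decidable (λ y → ∃[ y∈t ] proj₁ (from (y , y∈t)) ∈ X)
  dec y with y ∈? t
  ... | no  y∉t = no λ (y∈t , _) → y∉t y∈t
  ... | yes y∈t with proj₁ (from (y , y∈t)) ∈? X
  ...   | yes x∈X = yes (y∈t , x∈X)
  ...   | no  x∉X = no λ (y∈t′ , x∈X) →
            x∉X (subst (λ h → proj₁ (from (y , h)) ∈ X) ([]=-irrelevant y∈t′ y∈t) x∈X)

  Y = proj₁ (comprehension dec)
  ∈Y = λ {x} → proj₂ (comprehension dec) {x}

≅⇒∣E∣≡∣E∣ : {M : Matroid m} {N : Matroid n} → M ≅ N → ∣ E M ∣ ≡ ∣ E N ∣
≅⇒∣E∣≡∣E∣ M≅N = corresponds⇒∣X∣≡∣Y∣ (_≅_.bijection M≅N) (λ z → z) (λ z → z)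
  λ e → mk⇔ (λ _ → proj₂ (Inverse.to (_≅_.bijection M≅N) e)) (λ _ → proj₂ e)

≅⇒indep-image : {M : Matroid m} {N : Matroid n} → M ≅ N → ∀ {X} → X ⊆ E M →
                ∃[ Y ] Y ⊆ E N × ∣ X ∣ ≡ ∣ Y ∣ × (Indep M X ⇔ Indep N Y)
≅⇒indep-image M≅N {X} X⊆E with Y , Y⊆E , X~Y ← image (_≅_.bijection M≅N) X =
  Y , Y⊆E , corresponds⇒∣X∣≡∣Y∣ (_≅_.bijection M≅N) X⊆E Y⊆E X~Y , _≅_.indep⇔ M≅N X⊆E Y⊆E X~Y

enumerate : ∀ (p : Subset n) → ∃ (_∈ p) ↔ Fin ∣ p ∣
enumerate []          = mk↔ₛ′ (λ ()) (λ ()) (λ ()) λ ()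
enumerate (true ∷ p)  = mk↔ₛ′
  (λ { (zero , _) → zero ; (suc x , there x∈p) → suc (to (x , x∈p)) })
  (λ { zero → zero , here ; (suc i) → suc (proj₁ (from i)) , there (proj₂ (from i)) })
  (λ { zero → refl ; (suc i) → cong suc (strictlyInverseˡ i) })
  (λ { (zero , here) → refl
     ; (suc x , there x∈p) → ∈-pair-≡ (cong suc (cong proj₁ (strictlyInverseʳ (x , x∈p)))) })
  where open Inverse (enumerate p)
enumerate (false ∷ p) = mk↔ₛ′
  (λ { (suc x , there x∈p) → to (x , x∈p) })
  (λ i → suc (proj₁ (from i)) , there (proj₂ (from i)))
  strictlyInverseˡ
  (λ { (suc x , there x∈p) → ∈-pair-≡ (cong suc (cong proj₁ (strictlyInverseʳ (x , x∈p)))) })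
  where open Inverse (enumerate p)

∣p∣≡∣q∣⇒↔ : ∀ (p : Subset m) (q : Subset n) → ∣ p ∣ ≡ ∣ q ∣ → ∃ (_∈ p) ↔ ∃ (_∈ q)
∣p∣≡∣q∣⇒↔ p q eq =
  ↔-trans (subst (λ k → ∃ (_∈ p) ↔ Fin k) eq (enumerate p)) (↔-sym (enumerate q))

-- A form free of bijections: together with `∣ E M ∣ ≡ m` it is equivalent to `M ≅ U s m`.
Uniform : ℕ → Matroid n → Set
Uniform s M = ∀ {I} → I ⊆ E M → Indep M I ⇔ ∣ I ∣ ≤ s

uniform⇒≅U : ∀ {s} {M : Matroid n} → Uniform s M → ∣ E M ∣ ≡ m → M ≅ U s m
uniform⇒≅U {n} {m} {s} {M} unif ∣E∣ = record
  { bijection = φ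
  ; indep⇔ = λ {X} {Y} X⊆E Y⊆ X~Y → subst (λ k → Indep M X ⇔ k ≤ s)
      (corresponds⇒∣X∣≡∣Y∣ φ X⊆E Y⊆ X~Y) (unif X⊆E)
  }
  where
  φ : ∃ (_∈ E M) ↔ ∃ (_∈ ⊤ {m})
  φ = ∣p∣≡∣q∣⇒↔ (E M) (⊤ {m}) (trans ∣E∣ (sym (∣⊤∣≡n m)))

≅U⇒∣E∣ : ∀ {s} {M : Matroid n} → M ≅ U s m → ∣ E M ∣ ≡ m
≅U⇒∣E∣ {m = m} M≅U = trans (≅⇒∣E∣≡∣E∣ M≅U) (∣⊤∣≡n m)

≅U⇒uniform : ∀ {s} {M : Matroid n} → M ≅ U s m → Uniform s M
≅U⇒uniform {s = s} {M} M≅U {I} I⊆E with Y , _ , ∣I∣≡∣Y∣ , I⇔Y ← ≅⇒indep-image M≅U I⊆E =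
  subst (λ k → Indep M I ⇔ k ≤ s) (sym ∣I∣≡∣Y∣) I⇔Y

∣C∣≡1+s⇒circuit : ∀ {s} {M : Matroid n} → Uniform s M → ∀ {C} → C ⊆ E M → ∣ C ∣ ≡ suc s → Circuit M C
∣C∣≡1+s⇒circuit unif C⊆E ∣C∣ = C⊆E
  , (λ iC → <⇒≱ (≤-reflexive (sym ∣C∣)) (Equivalence.to (unif C⊆E) iC))
  , λ {X} (X⊆C , x) → Equivalence.from (unif (λ x∈X → C⊆E (X⊆C x∈X)))
      (s≤s⁻¹ (subst (∣ X ∣ <_) ∣C∣ (p⊂q⇒∣p∣<∣q∣ (X⊆C , x))))

-- A dependent set contains `suc s` elements that are already dependent, and minimality leaves no
-- others.
circuit⇒∣C∣≡1+s : ∀ {s} {M : Matroid n} → Uniform s M → ∀ {C} → Circuit M C → ∣ C ∣ ≡ suc s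
circuit⇒∣C∣≡1+s {s = s} unif {C} (C⊆E , ¬iC , min)
  with D , D⊆C , ∣D∣ ← subset-of-size (suc s) C (≰⇒> (¬iC ∘ Equivalence.from (unif C⊆E)))
  with C ⊆? D
... | yes C⊆D = trans (cong ∣_∣ (⊆-antisym C⊆D D⊆C)) ∣D∣
... | no  C⊈D = contradiction
  (Equivalence.to (unif (λ x∈D → C⊆E (D⊆C x∈D))) (min (p⊆q∧q⊈p⇒p⊂q D⊆C C⊈D)))
  (<⇒≱ (≤-reflexive (sym ∣D∣)))

-- Two-sums

module _ (M : Matroid n) where

  -- The components and the 2-sum must share one ambient `Fin`. Shifting all elements up frees point
  -- 0 for the basepoint, which lies outside the ground set of the sum.
  weaken : Matroid (suc n)
  weaken = record
    { E       = outside ∷ E M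
    ; Indep   = λ I → head I ≡ outside × Indep M (tail I)
    ; indep?  = λ I → (head I ≟ᵇ outside) ×-dec indep? M (tail I)
    ; indep⊆E = λ { {_ ∷ _} (refl , iI) → out⊆ (indep⊆E M iI) }
    ; ⊥-indep = refl , ⊥-indep M
    ; ⊆-indep = ⊆-weaken
    ; augment = augment-weaken
    }
    where
    ⊆-weaken : ∀ {I J : Subset (suc n)} → I ⊆ J → head J ≡ outside × Indep M (tail J) →
               head I ≡ outside × Indep M (tail I)
    ⊆-weaken {true  ∷ _} {_ ∷ _} I⊆J (refl , _) with () ← I⊆J here
    ⊆-weaken {false ∷ _} {_ ∷ _} I⊆J (_ , iJ) = refl , ⊆-indep M (drop-∷-⊆ I⊆J) iJ

    augment-weaken : ∀ {I J : Subset (suc n)} →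
                     head I ≡ outside × Indep M (tail I) → head J ≡ outside × Indep M (tail J) →
                     ∣ I ∣ < ∣ J ∣ →
                     ∃[ e ] e ∈ J × e ∉ I × head (I ∪ ⁅ e ⁆) ≡ outside × Indep M (tail (I ∪ ⁅ e ⁆))
    augment-weaken {_ ∷ _} {_ ∷ _} (refl , iI) (refl , iJ) ∣I∣<∣J∣
      with e , e∈J , e∉I , iI+e ← augment M iI iJ ∣I∣<∣J∣ =
      suc e , there e∈J , e∉I ∘ drop-there , refl , iI+e

  ≅-weaken : M ≅ weaken
  ≅-weaken = record
    { bijection = mk↔ₛ′ to from (λ { (suc x , there x∈E) → refl }) (λ _ → refl)
    ; indep⇔ = indep⇔
    }
    where
    to : ∃ (_∈ E M) → ∃ (_∈ outside ∷ E M)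
    to (x , x∈E) = suc x , there x∈E

    from : ∃ (_∈ outside ∷ E M) → ∃ (_∈ E M)
    from (suc x , there x∈E) = x , x∈E

    indep⇔ : ∀ {X Y} → X ⊆ E M → Y ⊆ outside ∷ E M → (∀ (e : ∃ (_∈ E M)) → proj₁ e ∈ X ⇔ suc (proj₁ e) ∈ Y) →
             Indep M X ⇔ Indep weaken Y
    indep⇔ {X} {true ∷ Y} X⊆E Y⊆E X~Y with () ← Y⊆E here
    indep⇔ {X} {false ∷ Y} X⊆E Y⊆E X~Y =
      mk⇔ (λ iX → refl , subst (Indep M) X≡Y iX) (λ (_ , iY) → subst (Indep M) (sym X≡Y) iY)
      where
      X≡Y : X ≡ Y
      X≡Y = ⊆-antisym (λ {x} x∈X → drop-there (Equivalence.to (X~Y (x , X⊆E x∈X)) x∈X))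
                      (λ {x} x∈Y → Equivalence.from (X~Y (x , drop-there (Y⊆E (there x∈Y)))) (there x∈Y))

  circuit-weaken⁺ : ∀ {C} → Circuit M C → Circuit weaken (outside ∷ C)
  circuit-weaken⁺ {C} (C⊆E , ¬iC , min) = out⊆ C⊆E , ¬iC ∘ proj₂ , min′
    where
    min′ : ∀ {X} → X ⊂ outside ∷ C → Indep weaken X
    min′ {true  ∷ X} (X⊆ , _) with () ← X⊆ here
    min′ {false ∷ X} X⊂ = refl , min (drop-∷-⊂ X⊂)

  circuit-weaken⁻ : ∀ {C} → Circuit weaken (outside ∷ C) → Circuit M C
  circuit-weaken⁻ (C⊆E , ¬iC , min) =
    drop-∷-⊆ C⊆E , (λ iC → ¬iC (refl , iC)) , λ X⊂C → proj₂ (min (out⊂ X⊂C))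

  restriction-circuit : ∀ {X C} → X ⊆ E M → Circuit (M ↾ X) C → Circuit M C
  restriction-circuit X⊆E (C⊆X , ¬iC , min) =
    X⊆E ∘ C⊆X , (λ iC → ¬iC (C⊆X , iC)) , λ X⊂C → proj₂ (min X⊂C)

  -- Any three points of the line form a circuit, so a circuit holding three of them holds nothing
  -- else.
  circuit-meeting-line : ∀ {L C} → L ⊆ E M → Uniform 2 (M ↾ L) → Circuit M C → 3 ≤ ∣ C ∩ L ∣ →
                         C ⊆ L × ∣ C ∣ ≡ 3
  circuit-meeting-line {L} {C} L⊆E unif (_ , _ , min) 3≤
    with D , D⊆ , ∣D∣ ← subset-of-size 3 (C ∩ L) 3≤
    with C ⊆? D
  ... | yes C⊆D = (λ x∈C → p∩q⊆q C L (D⊆ (C⊆D x∈C)))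
                , trans (cong ∣_∣ (⊆-antisym C⊆D (p∩q⊆p C L ∘ D⊆))) ∣D∣
  ... | no  C⊈D = contradiction (min (p⊆q∧q⊈p⇒p⊂q (p∩q⊆p C L ∘ D⊆) C⊈D))
    (proj₁ (proj₂ (restriction-circuit L⊆E
      (∣C∣≡1+s⇒circuit {M = M ↾ L} unif (λ x∈D → p∩q⊆q C L (D⊆ x∈D)) ∣D∣))))

-- Point 0 is the basepoint of the 2-sum below.
U₂⁺ : Subset n → Matroid (suc n)
U₂⁺ {n} L = U 2 (suc n) ↾ (inside ∷ L)

U₂⁺-uniform : (L : Subset n) → Uniform 2 (U₂⁺ L)
U₂⁺-uniform L I⊆ = mk⇔ proj₂ λ ∣I∣≤2 → (λ {x} → I⊆ {x}) , ∣I∣≤2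

U₂⁺-¬loop : (L : Subset n) → ¬ Loop (U₂⁺ L) zero
U₂⁺-¬loop {n} L loop = contradiction
  (trans (sym (∣⁅x⁆∣≡1 (zero {n}))) (circuit⇒∣C∣≡1+s {M = U₂⁺ L} (U₂⁺-uniform L) loop)) λ ()

-- Two points of `L` form a basis that avoids the basepoint.
U₂⁺-¬coloop : (L : Subset n) → 2 ≤ ∣ L ∣ → ¬ Coloop (U₂⁺ L) zero
U₂⁺-¬coloop L 2≤∣L∣ (_ , ¬coindep , _) with B , B⊆L , ∣B∣ ← subset-of-size 2 L 2≤∣L∣ =
  ¬coindep (outside ∷ B
    , ((out⊆ B⊆L , ≤-reflexive ∣B∣) , λ (_ , ∣J∣≤2) B⊆J →
        p⊆q∧∣q∣≤∣p∣⇒q⊆p B⊆J (≤-trans ∣J∣≤2 (≤-reflexive (sym ∣B∣))))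
    , x∈p⇒⁅x⁆⊆p here)

-- The hypotheses say that `L` and `L′` partition the ground set and that a subset of it is
-- independent exactly when it has at most three elements, at most two of them on each line.
module TwoLines (M : Matroid n) {k : ℕ} (2≤k : 2 ≤ k)
  {L L′ : Subset n} (L⊆E : L ⊆ E M) (L′⊆E : L′ ⊆ E M)
  (disjoint : ∀ {x} → x ∈ L′ → x ∉ L) (E⊆L∪L′ : E M ⊆ L ∪ L′)
  (∣L∣ : ∣ L ∣ ≡ k) (∣L′∣ : ∣ L′ ∣ ≡ k)
  (unif : Uniform 2 (M ↾ L)) (unif′ : Uniform 2 (M ↾ L′))
  (indep⇒∣I∣≤3 : ∀ {I} → Indep M I → ∣ I ∣ ≤ 3)
  (indep : ∀ {I} → I ⊆ E M → ∣ I ∩ L ∣ ≤ 2 → ∣ I ∩ L′ ∣ ≤ 2 → ∣ I ∣ ≤ 3 → Indep M I)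
  where

  M₁ M₂ : Matroid (suc n)
  M₁ = U₂⁺ L
  M₂ = U₂⁺ L′

  -- The cases are the three kinds of circuits of the 2-sum: `left`, `right` and `join`. Without
  -- three points on a line, dependence needs at least four elements, hence two on each line.
  line-or-split : ∀ {C} → Circuit M C →
                  (C ⊆ L × ∣ C ∣ ≡ 3) ⊎ (C ⊆ L′ × ∣ C ∣ ≡ 3) ⊎ (∣ C ∩ L ∣ ≡ 2 × ∣ C ∩ L′ ∣ ≡ 2)
  line-or-split {C} circ@(C⊆E , ¬iC , _) with 3 ≤? ∣ C ∩ L ∣ | 3 ≤? ∣ C ∩ L′ ∣
  ... | yes 3≤ | _      = inj₁ (circuit-meeting-line M L⊆E unif circ 3≤)
  ... | no _   | yes 3≤ = inj₂ (inj₁ (circuit-meeting-line M L′⊆E unif′ circ 3≤))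
  ... | no 3≰  | no 3≰′ = inj₂ (inj₂
      ( ≤-antisym a≤2 (+-cancelʳ-≤ 2 _ _ (≤-trans 4≤a+b (+-monoʳ-≤ (∣ C ∩ L ∣) b≤2)))
      , ≤-antisym b≤2 (+-cancelˡ-≤ 2 _ _ (≤-trans 4≤a+b (+-monoˡ-≤ (∣ C ∩ L′ ∣) a≤2)))))
    where
    a≤2 : ∣ C ∩ L ∣ ≤ 2
    a≤2 = s≤s⁻¹ (≰⇒> 3≰)

    b≤2 : ∣ C ∩ L′ ∣ ≤ 2
    b≤2 = s≤s⁻¹ (≰⇒> 3≰′)

    4≤a+b : 4 ≤ ∣ C ∩ L ∣ + ∣ C ∩ L′ ∣
    4≤a+b = ≤-trans (≰⇒> (λ ∣C∣≤3 → ¬iC (indep C⊆E a≤2 b≤2 ∣C∣≤3)))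
      (p⊆q∪s⇒∣p∣≤∣p∩q∣+∣p∩s∣ (E⊆L∪L′ ∘ C⊆E))

  split-circuit : ∀ {A B} → A ⊆ L → B ⊆ L′ → ∣ A ∣ ≡ 2 → ∣ B ∣ ≡ 2 → Circuit M (A ∪ B)
  split-circuit {A} {B} A⊆L B⊆L′ ∣A∣ ∣B∣ = A∪B⊆E , (λ iAB → <⇒≱ ∣A∪B∣≥4 (indep⇒∣I∣≤3 iAB)) , min
    where
    A∪B⊆E : A ∪ B ⊆ E M
    A∪B⊆E = ∪-lub (L⊆E ∘ A⊆L) (L′⊆E ∘ B⊆L′)

    ∣A∪B∣≥4 : 4 ≤ ∣ A ∪ B ∣
    ∣A∪B∣≥4 = subst (_≤ ∣ A ∪ B ∣) (cong₂ _+_ ∣A∣ ∣B∣) (disjoint⇒∣p∣+∣q∣≤∣r∣ (p⊆p∪q B) (q⊆p∪q A B)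
      λ x∈B x∈A → disjoint (B⊆L′ x∈B) (A⊆L x∈A))

    min : ∀ {X} → X ⊂ A ∪ B → Indep M X
    min {X} X⊂@(X⊆ , _) = indep (A∪B⊆E ∘ X⊆)
      (≤-trans (p⊆q⇒∣p∣≤∣q∣ X∩L⊆A) (≤-reflexive ∣A∣))
      (≤-trans (p⊆q⇒∣p∣≤∣q∣ X∩L′⊆B) (≤-reflexive ∣B∣))
      (s≤s⁻¹ (≤-trans (p⊂q⇒∣p∣<∣q∣ X⊂) (≤-trans (∣p∪q∣≤∣p∣+∣q∣ A B) (≤-reflexive (cong₂ _+_ ∣A∣ ∣B∣)))))
      where
      X∩L⊆A : X ∩ L ⊆ A
      X∩L⊆A x∈ with x∈X , x∈L ← x∈p∩q⁻ X L x∈ with x∈p∪q⁻ A B (X⊆ x∈X)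
      ... | inj₁ x∈A = x∈A
      ... | inj₂ x∈B = contradiction x∈L (disjoint (B⊆L′ x∈B))

      X∩L′⊆B : X ∩ L′ ⊆ B
      X∩L′⊆B x∈ with x∈X , x∈L′ ← x∈p∩q⁻ X L′ x∈ with x∈p∪q⁻ A B (X⊆ x∈X)
      ... | inj₁ x∈A = contradiction (A⊆L x∈A) (disjoint x∈L′)
      ... | inj₂ x∈B = x∈B

  circuit⇒two-sum : ∀ C → Circuit (weaken M) C → TwoSumCircuit M₁ M₂ zero C
  circuit⇒two-sum (true  ∷ C) (C⊆E , _) with () ← C⊆E here
  circuit⇒two-sum (false ∷ C) circ′ with circ@(C⊆E , _) ← circuit-weaken⁻ M circ′ with line-or-split circ
  ... | inj₁ (C⊆L , ∣C∣)         =
    left (∣C∣≡1+s⇒circuit {M = M₁} (U₂⁺-uniform L) (out⊆ C⊆L) ∣C∣) λ ()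
  ... | inj₂ (inj₁ (C⊆L′ , ∣C∣)) =
    right (∣C∣≡1+s⇒circuit {M = M₂} (U₂⁺-uniform L′) (out⊆ C⊆L′) ∣C∣) λ ()
  -- Deleting point 0 computes to `outside` at the head and to `_ ─ ⊥` on the tail, hence `p─⊥≡p`.
  ... | inj₂ (inj₂ (∣A∣ , ∣B∣))  = subst (TwoSumCircuit M₁ M₂ zero)
    (cong (outside ∷_) (trans (p─⊥≡p _) (sym C≡)))
    (join (∣C∣≡1+s⇒circuit {M = M₁} (U₂⁺-uniform L) (in⊆in (p∩q⊆q C L)) (cong suc ∣A∣)) here
          (∣C∣≡1+s⇒circuit {M = M₂} (U₂⁺-uniform L′) (in⊆in (p∩q⊆q C L′)) (cong suc ∣B∣)) here)
    where
    C≡ : C ≡ (C ∩ L) ∪ (C ∩ L′)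
    C≡ = ⊆-antisym
      (p⊆q∪s⇒p⊆p∩q∪p∩s (E⊆L∪L′ ∘ C⊆E)) (∪-lub (p∩q⊆p C L) (p∩q⊆p C L′))

  line-circuit : ∀ {N C} → N ⊆ E M → Uniform 2 (M ↾ N) → Circuit (U₂⁺ N) C → zero ∉ C →
                 Circuit (weaken M) C
  line-circuit {C = true ∷ C} _ _ _ 0∉C = contradiction here 0∉C
  line-circuit {N} {false ∷ C} N⊆E unifN circ@(C⊆ , _) _ =
    circuit-weaken⁺ M (restriction-circuit M N⊆E (∣C∣≡1+s⇒circuit {M = M ↾ N} unifN
      (drop-∷-⊆ C⊆) (circuit⇒∣C∣≡1+s {M = U₂⁺ N} (U₂⁺-uniform N) circ)))

  two-sum⇒circuit : ∀ {C} → TwoSumCircuit M₁ M₂ zero C → Circuit (weaken M) C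
  two-sum⇒circuit (left circ 0∉C)  = line-circuit L⊆E unif circ 0∉C
  two-sum⇒circuit (right circ 0∉C) = line-circuit L′⊆E unif′ circ 0∉C
  two-sum⇒circuit (join {true ∷ A} {true ∷ B} circA here circB here) =
    subst (λ C → Circuit (weaken M) (outside ∷ C)) (sym (p─⊥≡p _)) (circuit-weaken⁺ M
      (split-circuit (drop-∷-⊆ (proj₁ circA)) (drop-∷-⊆ (proj₁ circB))
        (suc-injective (circuit⇒∣C∣≡1+s {M = M₁} (U₂⁺-uniform L) circA))
        (suc-injective (circuit⇒∣C∣≡1+s {M = M₂} (U₂⁺-uniform L′) circB))))

  isTwoSum : IsTwoSum M₁ M₂ zero (weaken M)
  isTwoSum = record
    { meet     = cong (inside ∷_) (Empty-unique λ (x , x∈) →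
                   disjoint (p∩q⊆q L L′ x∈) (p∩q⊆p L L′ x∈))
    ; size₁    = s≤s 2≤∣L∣
    ; size₂    = s≤s 2≤∣L′∣
    ; ¬loop₁   = U₂⁺-¬loop L
    ; ¬loop₂   = U₂⁺-¬loop L′
    ; ¬coloop₁ = U₂⁺-¬coloop L 2≤∣L∣
    ; ¬coloop₂ = U₂⁺-¬coloop L′ 2≤∣L′∣
    ; ground   = cong (outside ∷_) (trans (⊆-antisym E⊆L∪L′ (∪-lub L⊆E L′⊆E)) (sym (p─⊥≡p _)))
    ; circuits = λ C → mk⇔ (circuit⇒two-sum C) two-sum⇒circuit
    }
    where
    2≤∣L∣ : 2 ≤ ∣ L ∣
    2≤∣L∣ = subst (2 ≤_) (sym ∣L∣) 2≤k

    2≤∣L′∣ : 2 ≤ ∣ L′ ∣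
    2≤∣L′∣ = subst (2 ≤_) (sym ∣L′∣) 2≤k

  ≅U⊕₂U : M ≅ U 2 (k + 1) ⊕₂ U 2 (k + 1)
  ≅U⊕₂U = suc n , M₁ , M₂ , zero , weaken M
    , uniform⇒≅U {M = M₁} (U₂⁺-uniform L) (trans (cong suc ∣L∣) (+-comm 1 k))
    , uniform⇒≅U {M = M₂} (U₂⁺-uniform L′) (trans (cong suc ∣L′∣) (+-comm 1 k))
    , isTwoSum , ≅-weaken M

module _ {M₁ M₂ S : Matroid n} {p : Fin n} (twoSum : IsTwoSum M₁ M₂ p S)
  (unif₁ : Uniform 2 M₁) (unif₂ : Uniform 2 M₂) where

  open IsTwoSum twoSum

  private
    p∈E₁∩E₂ : p ∈ E M₁ ∩ E M₂
    p∈E₁∩E₂ = subst (p ∈_) (sym meet) (x∈⁅x⁆ p)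

    p∈E₁ : p ∈ E M₁
    p∈E₁ = p∩q⊆p (E M₁) (E M₂) p∈E₁∩E₂

    p∈E₂ : p ∈ E M₂
    p∈E₂ = p∩q⊆q (E M₁) (E M₂) p∈E₁∩E₂

  -- The basepoint is counted twice on the right and is absent from `E S`.
  two-sum-∣E∣ : ∣ E S ∣ + 2 ≡ ∣ E M₁ ∣ + ∣ E M₂ ∣
  two-sum-∣E∣ = begin
    ∣ E S ∣ + 2                                  ≡⟨ +-assoc (∣ E S ∣) 1 1 ⟨
    ∣ E S ∣ + 1 + 1                              ≡⟨ cong (λ X → ∣ X ∣ + 1 + 1) ground ⟩
    ∣ (E M₁ ∪ E M₂) - p ∣ + 1 + 1                ≡⟨ cong (λ k → ∣ (E M₁ ∪ E M₂) - p ∣ + k + 1) (∣⁅x⁆∣≡1 p) ⟨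
    ∣ (E M₁ ∪ E M₂) - p ∣ + ∣ ⁅ p ⁆ ∣ + 1        ≡⟨ cong (_+ 1) (q⊆p⇒∣p∣≡∣p─q∣+∣q∣
                                                     (x∈p⇒⁅x⁆⊆p (p⊆p∪q (E M₂) p∈E₁))) ⟨
    ∣ E M₁ ∪ E M₂ ∣ + 1                          ≡⟨ cong (∣ E M₁ ∪ E M₂ ∣ +_)
                                                      (trans (cong ∣_∣ meet) (∣⁅x⁆∣≡1 p)) ⟨
    ∣ E M₁ ∪ E M₂ ∣ + ∣ E M₁ ∩ E M₂ ∣            ≡⟨ ∣p∪q∣+∣p∩q∣≡∣p∣+∣q∣ (E M₁) (E M₂) ⟩
    ∣ E M₁ ∣ + ∣ E M₂ ∣                          ∎
    where open ≡-Reasoning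

  -- Three points on one side would be a circuit avoiding `p`. With four points in all, two on each
  -- side complete with `p` to triangles, and their `join` lies in `I`.
  two-sum-indep⇒∣I∣≤3 : ∀ {I} → Indep S I → ∣ I ∣ ≤ 3
  two-sum-indep⇒∣I∣≤3 {I} iI = decidable-stable (∣ I ∣ ≤? 3) λ ∣I∣≰3 → ¬4≤∣I∣ (≰⇒> ∣I∣≰3)
    where
    ¬circuit⊆I : ∀ {C} → TwoSumCircuit M₁ M₂ p C → ¬ C ⊆ I
    ¬circuit⊆I {C} circ C⊆I =
      proj₁ (proj₂ (Equivalence.from (circuits C) circ)) (⊆-indep S C⊆I iI)

    I⊆E-p : I ⊆ (E M₁ ∪ E M₂) - p
    I⊆E-p = subst (I ⊆_) ground (indep⊆E S iI)

    p∉I : p ∉ I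
    p∉I p∈I = x∈p─q⇒x∉q (E M₁ ∪ E M₂) ⁅ p ⁆ (I⊆E-p p∈I) (x∈⁅x⁆ p)

    ∣I∣≤ : ∣ I ∣ ≤ ∣ I ∩ E M₁ ∣ + ∣ I ∩ E M₂ ∣
    ∣I∣≤ = p⊆q∪s⇒∣p∣≤∣p∩q∣+∣p∩s∣ (p─q⊆p (E M₁ ∪ E M₂) ⁅ p ⁆ ∘ I⊆E-p)

    a≤2 : ∣ I ∩ E M₁ ∣ ≤ 2
    a≤2 = s≤s⁻¹ (≰⇒> λ 3≤ → let (D , D⊆ , ∣D∣) = subset-of-size 3 _ 3≤ in
      ¬circuit⊆I (left (∣C∣≡1+s⇒circuit {M = M₁} unif₁ (λ x∈ → p∩q⊆q I (E M₁) (D⊆ x∈)) ∣D∣)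
                       (λ p∈D → p∉I (p∩q⊆p I (E M₁) (D⊆ p∈D))))
                 (λ x∈ → p∩q⊆p I (E M₁) (D⊆ x∈)))

    b≤2 : ∣ I ∩ E M₂ ∣ ≤ 2
    b≤2 = s≤s⁻¹ (≰⇒> λ 3≤ → let (D , D⊆ , ∣D∣) = subset-of-size 3 _ 3≤ in
      ¬circuit⊆I (right (∣C∣≡1+s⇒circuit {M = M₂} unif₂ (λ x∈ → p∩q⊆q I (E M₂) (D⊆ x∈)) ∣D∣)
                        (λ p∈D → p∉I (p∩q⊆p I (E M₂) (D⊆ p∈D))))
                 (λ x∈ → p∩q⊆p I (E M₂) (D⊆ x∈)))

    triangle : ∀ (N : Matroid n) → Uniform 2 N → p ∈ E N → 2 ≤ ∣ I ∩ E N ∣ →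
               ∃[ A ] A ⊆ I × Circuit N (A ∪ ⁅ p ⁆)
    triangle N unif p∈E 2≤ with A , A⊆ , ∣A∣ ← subset-of-size 2 (I ∩ E N) 2≤ =
      A , (λ x∈A → p∩q⊆p I (E N) (A⊆ x∈A))
        , ∣C∣≡1+s⇒circuit {M = N} unif (∪-lub (λ x∈A → p∩q⊆q I (E N) (A⊆ x∈A)) (x∈p⇒⁅x⁆⊆p p∈E))
            (trans (x∉p⇒∣p∪⁅x⁆∣≡1+∣p∣ A (λ p∈A → p∉I (p∩q⊆p I (E N) (A⊆ p∈A)))) (cong suc ∣A∣))

    p∈A∪⁅p⁆ : ∀ A → p ∈ A ∪ ⁅ p ⁆
    p∈A∪⁅p⁆ A = q⊆p∪q A ⁅ p ⁆ (x∈⁅x⁆ p)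

    ¬4≤∣I∣ : ¬ 4 ≤ ∣ I ∣
    ¬4≤∣I∣ 4≤∣I∣
      with A , A⊆I , circA ← triangle M₁ unif₁ p∈E₁
             (+-cancelʳ-≤ 2 _ _ (≤-trans 4≤∣I∣ (≤-trans ∣I∣≤ (+-monoʳ-≤ (∣ I ∩ E M₁ ∣) b≤2))))
      with B , B⊆I , circB ← triangle M₂ unif₂ p∈E₂
             (+-cancelˡ-≤ 2 _ _ (≤-trans 4≤∣I∣ (≤-trans ∣I∣≤ (+-monoˡ-≤ (∣ I ∩ E M₂ ∣) a≤2))))
      = ¬circuit⊆I (join circA (p∈A∪⁅p⁆ A) circB (p∈A∪⁅p⁆ B)) λ {x} x∈ →
          let x∉p = x∈p─q⇒x∉q _ ⁅ p ⁆ x∈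
              drop : ∀ D → D ⊆ I → x ∈ D ∪ ⁅ p ⁆ → x ∈ I
              drop D D⊆I = [ D⊆I , (λ x∈p → contradiction x∈p x∉p) ]′ ∘ x∈p∪q⁻ D ⁅ p ⁆
          in [ drop A A⊆I , drop B B⊆I ]′ (x∈p∪q⁻ (A ∪ ⁅ p ⁆) (B ∪ ⁅ p ⁆) (p─q⊆p _ ⁅ p ⁆ x∈))

-- The bound and its equality case

rank≤ : ∀ {s} (M : Matroid n) → (∀ {I} → Indep M I → ∣ I ∣ ≤ s) → rank M ≤ s
rank≤ M ∣I∣≤s = ∣I∣≤s (proj₁ (proj₂ (∃-basis M)))

≅⇒∣I∣≤s : ∀ {s} {M : Matroid m} {N : Matroid n} → M ≅ N → (∀ {I} → Indep N I → ∣ I ∣ ≤ s) →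
          ∀ {I} → Indep M I → ∣ I ∣ ≤ s
≅⇒∣I∣≤s {M = M} M≅N ∣I∣≤s iI with Y , _ , ∣I∣≡∣Y∣ , I⇔Y ← ≅⇒indep-image M≅N (indep⊆E M iI) =
  subst (_≤ _) (sym ∣I∣≡∣Y∣) (∣I∣≤s (Equivalence.to I⇔Y iI))

module MinimallyDegenerateMatroid (q : ℕ) (3≤q : 3 ≤ q) (M : Matroid n) (simple : Simple M)
  (minDeg : MinimallyDegenerate (suc q) M) where

  open MinimallyDegenerate minDeg
  open Rank M
  open SimpleMatroid M simple

  -- A cocircuit realising the cogirth of `M ↾ X`: in this form `minimal` enters the density
  -- argument.
  small-cocircuit : ∀ {X} → Nonempty X → X ⊂ E M → ∃[ C ] Cocircuit (M ↾ X) C × ∣ C ∣ ≤ q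
  small-cocircuit X≠∅ X⊂E with _ , ((C , C* , ∣C∣≡g) , _) , g≤q ← minimal X≠∅ X⊂E =
    C , C* , ≤-trans (≤-reflexive ∣C∣≡g) g≤q

  open Density q 3≤q M simple small-cocircuit

  -- Passes from the additive form of the bound to the one with `∸`, which is exact once the rank is
  -- at least 1.
  q*r : ∀ {s} → 1 ≤ s → 2 + q * s ≡ q * (s ∸ 1) + 2 + q
  q*r {suc s} _ = solve 2 (λ q s → con 2 :+ q :* (con 1 :+ s) := q :* s :+ con 2 :+ q) refl q s

  1≤rank : 1 ≤ rank M
  1≤rank = subst (1 ≤_) r-E≡rank (s≤∣X∣⇒s≤r (s≤s z≤n) (λ z → z) (x∈p⇒1≤∣p∣ (proj₂ nonempty)))

  bound : ∣ E M ∣ ≤ q * (rank M ∸ 1) + 2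
  bound = +-cancelʳ-≤ q _ _ (subst (∣ E M ∣ + q ≤_) (q*r 1≤rank)
    (subst (λ s → ∣ E M ∣ + q ≤ 2 + q * s) r-E≡rank (∣E∣-bound nonempty)))

  -- An upper bound for the rank suffices, as `bound` supplies the opposite inequality; so the rank
  -- of neither candidate has to be computed exactly.
  rank≤⇒attained : ∀ {s} → rank M ≤ suc s → ∣ E M ∣ ≡ q * s + 2 → ∣ E M ∣ ≡ q * (rank M ∸ 1) + 2
  rank≤⇒attained {s} rank≤s ∣E∣ = ≤-antisym bound (≤-trans
    (+-monoˡ-≤ 2 (*-monoʳ-≤ q (∸-monoˡ-≤ 1 rank≤s))) (≤-reflexive (sym ∣E∣)))

  ≅U⇒attained : M ≅ U 2 (suc q + 1) → ∣ E M ∣ ≡ q * (rank M ∸ 1) + 2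
  ≅U⇒attained M≅U = rank≤⇒attained {1} (rank≤ M (≅⇒∣I∣≤s M≅U (λ ∣I∣≤2 → ∣I∣≤2)))
    (trans (≅U⇒∣E∣ M≅U) (solve 1 (λ q → con 1 :+ q :+ con 1 := q :* con 1 :+ con 2) refl q))

  ≅U⊕₂U⇒attained : M ≅ U 2 (suc q + 1) ⊕₂ U 2 (suc q + 1) → ∣ E M ∣ ≡ q * (rank M ∸ 1) + 2
  ≅U⊕₂U⇒attained (_ , M₁ , M₂ , p , S , M₁≅U , M₂≅U , twoSum , M≅S) = rank≤⇒attained {2}
    (rank≤ M (≅⇒∣I∣≤s M≅S (two-sum-indep⇒∣I∣≤3 twoSum (≅U⇒uniform M₁≅U) (≅U⇒uniform M₂≅U))))
    (+-cancelʳ-≡ 2 _ _ (begin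
      ∣ E M ∣ + 2              ≡⟨ cong (_+ 2) (≅⇒∣E∣≡∣E∣ M≅S) ⟩
      ∣ E S ∣ + 2              ≡⟨ two-sum-∣E∣ twoSum (≅U⇒uniform M₁≅U) (≅U⇒uniform M₂≅U) ⟩
      ∣ E M₁ ∣ + ∣ E M₂ ∣      ≡⟨ cong₂ _+_ (≅U⇒∣E∣ M₁≅U) (≅U⇒∣E∣ M₂≅U) ⟩
      suc q + 1 + (suc q + 1)  ≡⟨ solve 1 (λ q → con 1 :+ q :+ con 1 :+ (con 1 :+ q :+ con 1)
                                             := q :* con 2 :+ con 2 :+ con 2) refl q ⟩
      q * 2 + 2 + 2            ∎))
    where open ≡-Reasoning

  line-uniform : ∀ {L} → Line L → Uniform 2 (M ↾ L)
  line-uniform {L} ((L⊆E , _) , rL) I⊆L = mk⇔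
    (λ (_ , iI) → subst (_ ≤_) rL (indep⇒∣I∣≤r iI I⊆L))
    (λ ∣I∣≤2 → (λ {x} → I⊆L {x}) , ∣I∣≤2⇒indep (λ x∈I → L⊆E (I⊆L x∈I)) ∣I∣≤2)

  module _ (attained : ∣ E M ∣ ≡ q * (rank M ∸ 1) + 2) where

    ∣E∣+q : ∣ E M ∣ + q ≡ 2 + q * r (E M)
    ∣E∣+q = trans (cong (_+ q) attained)
      (trans (sym (q*r 1≤rank)) (cong (λ s → 2 + q * s) (sym r-E≡rank)))

    -- In rank at most 1 a simple matroid has at most one element, but the attained value is at
    -- least 2.
    2≤rE : 2 ≤ r (E M)
    2≤rE = decidable-stable (2 ≤? r (E M)) λ 2≰r → contradiction (begin
      2                         ≤⟨ m≤n+m 2 _ ⟩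
      q * (rank M ∸ 1) + 2      ≡⟨ attained ⟨
      ∣ E M ∣                   ≤⟨ s≤s⁻¹ (r<2⇒∣X∣<2 (λ z → z) (≰⇒> 2≰r)) ⟩
      1                         ∎) λ { (s≤s ()) }
      where open ≤-Reasoning

    open Extremal ∣E∣+q 2≤rE

    rank-2 : r (E M) ≤ 2 → M ≅ U 2 (suc q + 1)
    rank-2 rE≤2 = uniform⇒≅U
      (λ I⊆E → mk⇔ (λ iI → ≤-trans (indep⇒∣I∣≤r iI I⊆E) rE≤2) (∣I∣≤2⇒indep I⊆E))
      (+-cancelʳ-≡ q _ _ (begin
        ∣ E M ∣ + q         ≡⟨ ∣E∣+q ⟩
        2 + q * r (E M)     ≡⟨ cong (λ s → 2 + q * s) (≤-antisym rE≤2 2≤rE) ⟩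
        2 + q * 2           ≡⟨ solve 1 (λ q → con 2 :+ q :* con 2 := con 1 :+ q :+ con 1 :+ q) refl q ⟩
        suc q + 1 + q       ∎))
      where open ≡-Reasoning

    rank-≥3 : 3 ≤ r (E M) → M ≅ U 2 (suc q + 1) ⊕₂ U 2 (suc q + 1)
    rank-≥3 3≤rE
      with L , L′ , lL@((L⊆E , _) , _) , lL′@((L′⊆E , _) , _) , disjoint , E⊆L∪L′ ← two-lines 3≤rE
      = TwoLines.≅U⊕₂U M (s≤s 1≤q) L⊆E L′⊆E disjoint E⊆L∪L′ (∣L∣≡1+q lL) (∣L∣≡1+q lL′)
          (line-uniform lL) (line-uniform lL′)
          (λ iI → ≤-trans (indep⇒∣I∣≤r iI (indep⊆E M iI)) rE≤3) indep
      where
      open ≤-Reasoning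

      -- Two lines hold at most `2 * suc q` elements, while attainment in rank 4 or more would need
      -- at least `q * 3 + 2`.
      rE≤3 : r (E M) ≤ 3
      rE≤3 = s≤s⁻¹ (*-cancelˡ-< q _ _ (+-cancelˡ-≤ 1 _ _ (begin
        2 + q * r (E M)         ≡⟨ ∣E∣+q ⟨
        ∣ E M ∣ + q             ≤⟨ +-monoˡ-≤ q (≤-trans (p⊆q⇒∣p∣≤∣q∣ E⊆L∪L′) (∣p∪q∣≤∣p∣+∣q∣ L L′)) ⟩
        ∣ L ∣ + ∣ L′ ∣ + q      ≡⟨ cong₂ (λ a b → a + b + q) (∣L∣≡1+q lL) (∣L∣≡1+q lL′) ⟩
        suc q + suc q + q       ≡⟨ solve 1 (λ q → con 1 :+ q :+ (con 1 :+ q) :+ q := con 2 :+ q :* con 3) refl q ⟩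
        1 + (1 + q * 3)         ≤⟨ s≤s (+-monoˡ-≤ (q * 3) 1≤q) ⟩
        1 + (q + q * 3)         ≡⟨ cong suc (*-suc q 3) ⟨
        1 + q * 4               ∎)))

      -- The line `N` is closed and `I` reaches outside it, so `r I` exceeds the rank of `I ∩ N`,
      -- which is at least 2 by simplicity.
      spans : ∀ {N I} → Line N → I ⊆ E M → 2 ≤ ∣ I ∩ N ∣ → ∣ I ∩ N ∣ < ∣ I ∣ → ∣ I ∣ ≤ 3 → Indep M I
      spans {N} {I} (tN@(N⊆E , _) , rN) I⊆E 2≤ <∣I∣ ∣I∣≤3 = ∣I∣≤r⇒indep (≤-trans ∣I∣≤3 (begin
        3               ≤⟨ s≤s (s≤∣X∣⇒s≤r ≤-refl (λ x∈ → I⊆E (p∩q⊆p I N x∈)) 2≤) ⟩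
        suc (r (I ∩ N)) ≤⟨ r[Z∩Y]<rZ tN (subst (_< r (E M)) (sym rN) 3≤rE) I⊆E
                             (λ I⊆N → <⇒≱ <∣I∣ (p⊆q⇒∣p∣≤∣q∣ λ x∈I → x∈p∩q⁺ (x∈I , I⊆N x∈I))) ⟩
        r I             ∎))

      indep : ∀ {I} → I ⊆ E M → ∣ I ∩ L ∣ ≤ 2 → ∣ I ∩ L′ ∣ ≤ 2 → ∣ I ∣ ≤ 3 → Indep M I
      indep {I} I⊆E a≤2 b≤2 ∣I∣≤3 with ∣ I ∣ ≤? 2 | 2 ≤? ∣ I ∩ L ∣
      ... | yes ∣I∣≤2 | _      = ∣I∣≤2⇒indep I⊆E ∣I∣≤2
      ... | no  ∣I∣≰2 | yes 2≤ = spans lL I⊆E 2≤ (≤-<-trans a≤2 (≰⇒> ∣I∣≰2)) ∣I∣≤3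
      -- Fewer than two of the three points on `L` leave at least two on `L′`.
      ... | no  ∣I∣≰2 | no  2≰ = spans lL′ I⊆E
        (+-cancelˡ-≤ 1 2 (∣ I ∩ L′ ∣) (≤-trans (≰⇒> ∣I∣≰2) (≤-trans (p⊆q∪s⇒∣p∣≤∣p∩q∣+∣p∩s∣ (E⊆L∪L′ ∘ I⊆E))
          (+-monoˡ-≤ _ (s≤s⁻¹ (≰⇒> 2≰))))))
        (≤-<-trans b≤2 (≰⇒> ∣I∣≰2)) ∣I∣≤3

    classify : (M ≅ U 2 (suc q + 1)) ⊎ (M ≅ U 2 (suc q + 1) ⊕₂ U 2 (suc q + 1))
    classify with r (E M) ≤? 2
    ... | yes rE≤2 = inj₁ (rank-2 rE≤2)
    ... | no  rE≰2 = inj₂ (rank-≥3 (≰⇒> rE≰2))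

theorem1p2 : ∀ {n} (k : ℕ) → 4 ≤ k → (M : Matroid n) → Simple M → MinimallyDegenerate k M →
    (∣ E M ∣ ≤ (k ∸ 1) * (rank M ∸ 1) + 2) ×
    (∣ E M ∣ ≡ (k ∸ 1) * (rank M ∸ 1) + 2 ⇔ ((M ≅ U 2 (k + 1)) ⊎ (M ≅ U 2 (k + 1) ⊕₂ U 2 (k + 1))))
theorem1p2 (suc q) (s≤s 3≤q) M simple minDeg =
  bound , mk⇔ classify [ ≅U⇒attained , ≅U⊕₂U⇒attained ]′
  where open MinimallyDegenerateMatroid q 3≤q M simple minDeg
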